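{- The following problem is $\mathsf{PSPACE}$-hard: given a one-counter Markov decision process $\mathcal{A}=(Q,\delta_0,\delta_{>0},f_0,f_{>0})$, a set $R\subseteq Q$ and a control location $q\in Q$, decide whether $(q,0)\in\mathrm{ValOne}(R)$.
   Context: A probability distribution on a finite nonempty set $S$ is a function $S\to\mathbb{Q}\cap[0,1]$ summing to $1$. A Markov decision process (MDP) is $\mathcal{D}=(V,\hookrightarrow,f)$ where $(V,\hookrightarrow)$ is a directed graph in which every vertex has finitely many and at least one successor, $V=V_N\uplus V_P$ (nondeterministic and probabilistic vertices), and $f$ assigns to each $v\in V_P$ a probability distribution on its successors. A strategy $\sigma$ assigns to each $wv$ with $w\in V^*$, $v\in V_N$ a probability distribution on the successors of $v$. It determines a Markov chain $\mathcal{D}(\sigma)$ on state set $V^+$ where $wv$ moves to $wvv'$ (for $v\hookrightarrow v'$) with probability $f(v)(v')$ if $v\in V_P$ and $\sigma(wv)(v')$ if $v\in V_N$. For $T\subseteq V$ and $v\in V$, $\mathcal{P}(\mathrm{Reach}^\sigma_T(v))$ is the probability, in $\mathcal{D}(\sigma)$ started in $v$, of the set of runs that eventually visit a state of the form $wu$ with $u\in T$, and $\mathrm{Reach}_T(v)=\sup_\sigma\mathcal{P}(\mathrm{Reach}^\sigma_T(v))$. A one-counter MDP (OC-MDP) is $\mathcal{A}=(Q,\delta_0,\delta_{>0},f_0,f_{>0})$ with $Q=Q_N\uplus Q_P$ finite, $\delta_0\subseteq Q\times\{0,1\}\times Q$, $\delta_{>0}\subseteq Q\times\{ -1,0,1\}\times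 Q$ such that every $q\in Q$ has at least one outgoing transition in each of $\delta_0$ and $\delta_{>0}$, and $f_0$ (resp. $f_{>0}$) assigns to each $q\in Q_P$ a probability distribution over its outgoing transitions in $\delta_0$ (resp. $\delta_{>0}$). It defines the MDP $\mathcal{D}(\mathcal{A})$ with $V_N=Q_N\times\mathbb{N}$, $V_P=Q_P\times\mathbb{N}$, and $(q,n)\hookrightarrow(q',n+i)$ iff either $n=0$ and $(q,i,q')\in\delta_0$ (probability $f_0(q,i,q')$) or $n>0$ and $(q,i,q')\in\delta_{>0}$ (probability $f_{>0}(q,i,q')$). For $R\subseteq Q$, $\mathrm{ValOne}(R)=\{(q,n)\in Q\times\mathbb{N}\mid \mathrm{Reach}_{R\times\{0\}}(q,n)=1\}$, computed in $\mathcal{D}(\mathcal{A})$. -}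

module Defs where

open import Data.Bool.Base using (Bool; true; false; if_then_else_)
open import Data.Digit using (toDigits)
open import Data.Empty using (⊥)
open import Data.Fin.Base using (Fin; toℕ)
open import Data.Fin.Patterns using (0F; 1F; 2F; 3F; 4F; 5F; 6F; 7F; 8F; 9F)
open import Data.Integer.Base using (∣_∣)
open import Data.List.Base as List
  using (List; []; _∷_; _++_; _∷ʳ_; concat; length; replicate)
open import Data.Maybe.Base using (Maybe; just; nothing)
open import Data.Nat.Base as ℕ using (ℕ; zero; suc)
open import Data.Product.Base using (_×_; _,_; ∃; ∃-syntax; Σ-syntax; proj₁; proj₂)
open import Data.Rational.Base as ℚ using (ℚ; 0ℚ; 1ℚ; ↥_; ↧ₙ_)
open import Data.Rational.Properties using (+-0-commutativeMonoid)
open import Data.Sum.Base using (_⊎_; inj₁; inj₂)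
open import Data.Vec.Base as Vec using (Vec; _∷_)
open import Function.Base using (_∘_; id)
open import Function.Bundles using (_⇔_; _↔_; mk↔ₛ′)
open import Function.Definitions using (Injective)
open import Relation.Binary.PropositionalEquality using (_≡_; refl; cong; cong₂)

open import Algebra.Properties.CommutativeMonoid.Sum +-0-commutativeMonoid
  using (sum)

------------------------------------------------------------------------
-- Finite nonempty sets and rational distributions on them

-- A finite nonempty subset of A, enumerated without repetition; the order of
-- the enumeration carries no meaning.
record FinSet⁺ (A : Set) : Set where
  field
    size-1       : ℕ
    at           : Fin (suc size-1) → A
    at-injective : Injective _≡_ _≡_ at

  size : ℕ
  size = suc size-1

open FinSet⁺ public

image : {A B : Set} (g : A → B) → Injective _≡_ _≡_ g → FinSet⁺ A → FinSet⁺ B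
image g g-inj S = record
  { size-1       = size-1 S
  ; at           = g ∘ at S
  ; at-injective = at-injective S ∘ g-inj
  }

-- A distribution on S : FinSet⁺ A is given along the enumeration of S, as an
-- element of Dist (size S).
record Dist (n : ℕ) : Set where
  field
    weight : Fin n → ℚ
    0≤w    : ∀ i → 0ℚ ℚ.≤ weight i
    w≤1    : ∀ i → weight i ℚ.≤ 1ℚ
    sum≡1  : sum weight ≡ 1ℚ

open Dist public

------------------------------------------------------------------------
-- Markov chains and reachability probabilities

-- A real number, represented by the set of rationals strictly below it.
LowerReal : Set₁
LowerReal = ℚ → Set

⌊_⌋ : ℚ → LowerReal
⌊ x ⌋ r = r ℚ.< x

_≐_ : LowerReal → LowerReal → Set
x ≐ y = ∀ r → x r ⇔ y r

-- r lies strictly below a supremum iff it lies strictly below some member.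
⨆ : {I : Set} → (I → LowerReal) → LowerReal
⨆ x r = ∃[ i ] x i r

record MarkovChain : Set₁ where
  field
    State : Set
    next  : State → FinSet⁺ State
    prob  : (s : State) → Dist (size (next s))

  module _ (T : State → Bool) where

    -- The probability of the runs from s that visit T within the first n steps.
    reachWithin : ℕ → State → ℚ
    reachWithin zero    s = if T s then 1ℚ else 0ℚ
    reachWithin (suc n) s =
      if T s then 1ℚ
      else sum λ i → weight (prob s) i ℚ.* reachWithin n (at (next s) i)

    -- The runs that eventually visit T are the increasing union over n of those
    -- that visit T within n steps, so by continuity of the measure their
    -- probability is the supremum of the probabilities of the latter.
    reachProb : State → LowerReal
    reachProb s = ⨆ λ n → ⌊ reachWithin n s ⌋

------------------------------------------------------------------------
-- Markov decision processes

record MDP : Set₁ where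
  field
    V-N V-P : Set

  V : Set
  V = V-N ⊎ V-P

  field
    succ : V → FinSet⁺ V
    f    : (v : V-P) → Dist (size (succ (inj₂ v)))

  Strategy : Set
  Strategy = List V → (v : V-N) → Dist (size (succ (inj₁ v)))

  -- V⁺: the pair (w , v) is the word wv.
  V⁺ : Set
  V⁺ = List V × V

  extend : V⁺ → V → V⁺
  extend (w , v) v′ = w ∷ʳ v , v′

  extend-injective : ∀ x → Injective _≡_ _≡_ (extend x)
  extend-injective _ refl = refl

  chain : Strategy → MarkovChain
  chain σ = record
    { State = V⁺
    ; next  = λ { x@(_ , v) → image (extend x) (extend-injective x) (succ v) }
    ; prob  = λ { (w , inj₁ v) → σ w v ; (_ , inj₂ v) → f v }
    }

  Reach^ : Strategy → (V → Bool) → V → LowerReal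
  Reach^ σ T v = MarkovChain.reachProb (chain σ) (λ { (_ , u) → T u }) ([] , v)

  Reach : (V → Bool) → V → LowerReal
  Reach T v = ⨆ λ σ → Reach^ σ T v

------------------------------------------------------------------------
-- One-counter Markov decision processes

data Step₀ : Set where
  stay up : Step₀

data Step₊ : Set where
  down stay up : Step₊

move₀ : Step₀ → ℕ
move₀ stay = 0
move₀ up   = 1

-- move₊ n i is the counter value reached from 1 + n.
move₊ : ℕ → Step₊ → ℕ
move₊ n down = n
move₊ n stay = suc n
move₊ n up   = suc (suc n)

move₀-injective : Injective _≡_ _≡_ move₀
move₀-injective {stay} {stay} _ = refl
move₀-injective {up}   {up}   _ = refl

move₊-injective : ∀ n → Injective _≡_ _≡_ (move₊ n)
move₊-injective n {down} {down} _ = refl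
move₊-injective n {stay} {stay} _ = refl
move₊-injective n {up}   {up}   _ = refl
move₊-injective n {down} {stay} ()
move₊-injective n {down} {up}   ()
move₊-injective n {stay} {down} ()
move₊-injective n {stay} {up}   ()
move₊-injective n {up}   {down} ()
move₊-injective n {up}   {stay} ()

record OC-MDP : Set where
  field
    #N #P : ℕ

  Q-N : Set
  Q-N = Fin #N

  Q-P : Set
  Q-P = Fin #P

  Q : Set
  Q = Q-N ⊎ Q-P

  -- δ₀ q is the set of pairs (i , q′) with (q , i , q′) ∈ δ₀, and likewise δ₊.
  field
    δ₀ : Q → FinSet⁺ (Step₀ × Q)
    δ₊ : Q → FinSet⁺ (Step₊ × Q)
    f₀ : (q : Q-P) → Dist (size (δ₀ (inj₂ q)))
    f₊ : (q : Q-P) → Dist (size (δ₊ (inj₂ q)))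

  Vertex : Set
  Vertex = (Q-N × ℕ) ⊎ (Q-P × ℕ)

  vertex : Q × ℕ → Vertex
  vertex (inj₁ q , n) = inj₁ (q , n)
  vertex (inj₂ q , n) = inj₂ (q , n)

  config : Vertex → Q × ℕ
  config (inj₁ (q , n)) = inj₁ q , n
  config (inj₂ (q , n)) = inj₂ q , n

  vertex-injective : Injective _≡_ _≡_ vertex
  vertex-injective {inj₁ _ , _} {inj₁ _ , _} refl = refl
  vertex-injective {inj₂ _ , _} {inj₂ _ , _} refl = refl

  target : {S : Set} → (S → ℕ) → S × Q → Vertex
  target move (i , q) = vertex (q , move i)

  target-injective : {S : Set} {move : S → ℕ} → Injective _≡_ _≡_ move →
                     Injective _≡_ _≡_ (target move)
  target-injective move-inj eq with vertex-injective eq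
  ... | eq′ = cong₂ _,_ (move-inj (cong proj₂ eq′)) (cong proj₁ eq′)

  successors : Q × ℕ → FinSet⁺ Vertex
  successors (q , zero)  = image (target move₀) (target-injective move₀-injective) (δ₀ q)
  successors (q , suc n) = image (target (move₊ n)) (target-injective (move₊-injective n)) (δ₊ q)

  mdp : MDP
  mdp = record
    { V-N  = Q-N × ℕ
    ; V-P  = Q-P × ℕ
    ; succ = λ v → successors (config v)
    ; f    = λ { (q , zero) → f₀ q ; (q , suc _) → f₊ q }
    }

  inZero : (Q → Bool) → Q × ℕ → Bool
  inZero R (q , zero)  = R q
  inZero R (_ , suc _) = false

  ValOne : (Q → Bool) → Q × ℕ → Set
  ValOne R c = MDP.Reach mdp (λ v → inZero R (config v)) (vertex c) ≐ ⌊ 1ℚ ⌋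

------------------------------------------------------------------------
-- Turing machines

Language : Set → Set₁
Language Σ = List Σ → Set

Finite : Set → Set
Finite A = ∃[ n ] A ↔ Fin n

-- Polynomials with natural coefficients, constant term first.
Poly : Set
Poly = List ℕ

eval : Poly → ℕ → ℕ
eval []       n = 0
eval (a ∷ as) n = a ℕ.+ n ℕ.* eval as n

data Shift : Set where
  left stay right : Shift

-- A two-way infinite tape, blank (nothing) outside the recorded cells.  The
-- list before holds the cells to the left of the head, nearest first.
record Tape (Γ : Set) : Set where
  constructor tape
  field
    before : List (Maybe Γ)
    head   : Maybe Γ
    after  : List (Maybe Γ)

open Tape

module _ {Γ : Set} where

  shift : Shift → Tape Γ → Tape Γ
  shift stay  t                  = t
  shift left  (tape []       x r) = tape [] nothing (x ∷ r)
  shift left  (tape (y ∷ l)  x r) = tape l y (x ∷ r)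
  shift right (tape l x [])       = tape (x ∷ l) nothing []
  shift right (tape l x (y ∷ r))  = tape (x ∷ l) y r

  act : Maybe Γ × Shift → Tape Γ → Tape Γ
  act (x , d) (tape l _ r) = shift d (tape l x r)

  emptyTape : Tape Γ
  emptyTape = tape [] nothing []

  wordTape : List Γ → Tape Γ
  wordTape []      = emptyTape
  wordTape (x ∷ w) = tape [] (just x) (List.map just w)

  -- Every visited cell stays recorded, so this counts the visited cells
  -- together with the cells of the initial word.
  cells : Tape Γ → ℕ
  cells (tape l _ r) = length l ℕ.+ suc (length r)

-- Deterministic multitape machines with input alphabet Σ, input on the first
-- tape, and a write-only output tape over Δ (deciders take Δ = ⊥).  The
-- machine halts when δ returns nothing.
record TM (Σ Δ : Set) : Set₁ where
  field
    State Γ      : Set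
    State-finite : Finite State
    Γ-finite     : Finite Γ
    inputSymbol  : Σ → Γ
    extraTapes   : ℕ

  tapes : ℕ
  tapes = suc extraTapes

  field
    start     : State
    accepting : State → Bool
    δ         : State → Vec (Maybe Γ) tapes →
                Maybe (State × Vec (Maybe Γ × Shift) tapes × Maybe Δ)

  record Config : Set where
    constructor ⟨_,_,_⟩
    field
      state    : State
      contents : Vec (Tape Γ) tapes
      output   : List Δ

  open Config public

  transition : Config → Maybe (State × Vec (Maybe Γ × Shift) tapes × Maybe Δ)
  transition c = δ (state c) (Vec.map head (contents c))

  Halted : Config → Set
  Halted c = transition c ≡ nothing

  step : Config → Config
  step c with transition c
  ... | nothing             = c
  ... | just (q , as , out) =
    ⟨ q , Vec.zipWith act as (contents c) , output c ++ List.fromMaybe out ⟩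

  run : ℕ → Config → Config
  run zero    c = c
  run (suc t) c = run t (step c)

  initial : List Σ → Config
  initial w =
    ⟨ start
    , wordTape (List.map inputSymbol w) ∷ Vec.replicate extraTapes emptyTape
    , [] ⟩

  space : Config → ℕ
  space c = Vec.sum (Vec.map cells (contents c))

  DecidesInSpace : (ℕ → ℕ) → Language Σ → Set
  DecidesInSpace bound L = ∀ w →
    (∀ t → space (run t (initial w)) ℕ.≤ bound (length w)) ×
    (∃[ t ] let c = run t (initial w) in
       Halted c × (L w ⇔ accepting (state c) ≡ true))

  ComputesInTime : (ℕ → ℕ) → (List Σ → List Δ) → Set
  ComputesInTime bound g = ∀ w →
    let c = run (bound (length w)) (initial w) in
    Halted c × output c ≡ g w

------------------------------------------------------------------------
-- Complexity

PSPACE : {Σ : Set} → Language Σ → Set₁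
PSPACE {Σ} L = Σ[ M ∈ TM Σ ⊥ ] ∃[ p ] DecidesInSpace M (eval p) L
  where open TM

PolyTime : {Σ Δ : Set} → (List Σ → List Δ) → Set₁
PolyTime {Σ} {Δ} g = Σ[ M ∈ TM Σ Δ ] ∃[ p ] ComputesInTime M (eval p) g
  where open TM

record DecisionProblem : Set₁ where
  field
    Instance        : Set
    Alphabet        : Set
    Alphabet-finite : Finite Alphabet
    encode          : Instance → List Alphabet
    Yes             : Instance → Set

-- Hardness under polynomial-time many-one reductions.
PSPACE-hard : DecisionProblem → Set₁
PSPACE-hard Π =
  ∀ {k} (L : Language (Fin k)) → PSPACE L →
  ∃[ g ] PolyTime (encode ∘ g) × (∀ w → L w ⇔ Yes (g w))
  where open DecisionProblem Π

------------------------------------------------------------------------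
-- The problem (q , 0) ∈ ValOne(R) and the encoding of its instances

record ValOneInstance : Set where
  field
    A : OC-MDP
  open OC-MDP A public
  field
    R : Q → Bool
    q : Q

data Symbol : Set where
  bit                : Fin 2 → Symbol
  nondet probab tally : Symbol
  sign               : Step₊ → Symbol
  sep end            : Symbol

Symbol-finite : Finite Symbol
Symbol-finite = 10 , mk↔ₛ′ to from to∘from from∘to
  where
  to : Symbol → Fin 10
  to (bit 0F)    = 0F
  to (bit 1F)    = 1F
  to nondet      = 2F
  to probab       = 3F
  to tally       = 4F
  to (sign down) = 5F
  to (sign stay) = 6F
  to (sign up)   = 7F
  to sep         = 8F
  to end         = 9F

  from : Fin 10 → Symbol
  from 0F = bit 0F
  from 1F = bit 1F
  from 2F = nondet
  from 3F = probab
  from 4F = tally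
  from 5F = sign down
  from 6F = sign stay
  from 7F = sign up
  from 8F = sep
  from 9F = end

  to∘from : ∀ i → to (from i) ≡ i
  to∘from 0F = refl
  to∘from 1F = refl
  to∘from 2F = refl
  to∘from 3F = refl
  to∘from 4F = refl
  to∘from 5F = refl
  to∘from 6F = refl
  to∘from 7F = refl
  to∘from 8F = refl
  to∘from 9F = refl

  from∘to : ∀ s → from (to s) ≡ s
  from∘to (bit 0F)    = refl
  from∘to (bit 1F)    = refl
  from∘to nondet      = refl
  from∘to probab       = refl
  from∘to tally       = refl
  from∘to (sign down) = refl
  from∘to (sign stay) = refl
  from∘to (sign up)   = refl
  from∘to sep         = refl
  from∘to end         = refl

encodeℕ : ℕ → List Symbol
encodeℕ n = List.map bit (proj₁ (toDigits 2 n)) ∷ʳ sep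

-- Only used for nonnegative rationals.
encodeℚ : ℚ → List Symbol
encodeℚ x = encodeℕ ∣ ↥ x ∣ ++ encodeℕ (↧ₙ x)

fromStep₀ : Step₀ → Step₊
fromStep₀ stay = stay
fromStep₀ up   = up

-- An instance is written as the blocks of its nondeterministic locations, then
-- the blocks of its probabilistic ones, then q.  A block holds the membership
-- of the location in R and its outgoing transitions in δ₀ and in δ₊, with
-- binary probabilities at probabilistic locations.  Location indices are
-- unary; every location has a block, so this costs at most a polynomial factor.
module _ (I : ValOneInstance) where
  open ValOneInstance I

  encodeLocation : Q → List Symbol
  encodeLocation (inj₁ j) = nondet ∷ replicate (toℕ j) tally ∷ʳ sep
  encodeLocation (inj₂ j) = probab  ∷ replicate (toℕ j) tally ∷ʳ sep

  encodeTransitions : {S : Set} → (S → Step₊) → (δ : FinSet⁺ (S × Q)) →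
                      (Fin (size δ) → List Symbol) → List Symbol
  encodeTransitions toStep δ label =
    concat (List.tabulate λ i → let (s , q′) = at δ i in
      sign (toStep s) ∷ encodeLocation q′ ++ label i) ∷ʳ end

  encodeNondet : Q-N → List Symbol
  encodeNondet j =
    bit (if R (inj₁ j) then 1F else 0F)
    ∷ encodeTransitions fromStep₀ (δ₀ (inj₁ j)) (λ _ → [])
    ++ encodeTransitions id (δ₊ (inj₁ j)) (λ _ → [])

  encodeProb : Q-P → List Symbol
  encodeProb j =
    bit (if R (inj₂ j) then 1F else 0F)
    ∷ encodeTransitions fromStep₀ (δ₀ (inj₂ j)) (encodeℚ ∘ weight (f₀ j))
    ++ encodeTransitions id (δ₊ (inj₂ j)) (encodeℚ ∘ weight (f₊ j))

  encodeInstance : List Symbol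
  encodeInstance =
    concat (List.tabulate encodeNondet) ∷ʳ end
    ++ concat (List.tabulate encodeProb) ∷ʳ end
    ++ encodeLocation q

ValOneProblem : DecisionProblem
ValOneProblem = record
  { Instance        = ValOneInstance
  ; Alphabet        = Symbol
  ; Alphabet-finite = Symbol-finite
  ; encode          = encodeInstance
  ; Yes             = λ I → let open ValOneInstance I in ValOne R (q , 0)
  }

{-# OPTIONS --safe #-}

-- Let M decide L in polynomial space.  Statements "at time n, M is in state q",
-- "the head on tape j scans γ" and "the cell i places left (right) of the head
-- on tape j holds γ" at time n + 1 reduce to such statements at time n once the
-- state and the scanned symbols at time n are known.  In the OC-MDP the counter
-- is the time: a claim at time n + 1 lets the player name that state and those
-- symbols, and a randomly drawn one of the claims this commits the player to is
-- continued with at time n, until R tells which claims hold at time 0.  True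
-- claims are won surely; false ones are lost with probability at least K⁻ⁿ,
-- where K is the number of claims to draw from.
--
-- That bound depends on n, so if the player chose n, the value could be one
-- without being attained.  Instead n is drawn at random with weights 2⁻ⁿ⁻¹, and
-- the claim is that M does not halt and reject before time n.  As M halts, it
-- accepts iff this claim holds for every n, and a single n at which it fails
-- keeps the value away from one.
--
-- Beyond the space bound all cells are blank, so polynomially many claims are
-- enough.  Indices of locations are affine in the distance of a cell from the
-- head, and the encoding of the OC-MDP is printed by a program with a few unary
-- counters whose loops run over that distance.
module Submission where

import Algebra.Properties.CommutativeMonoid.Sum
import Algebra.Solver.Monoid
open import Algebra.Bundles using (CommutativeRing)
open import Algebra.Properties.Semiring.Sum using (*-distribʳ-sum)
open import Data.Bool.Base using (Bool; true; false; not; _∧_; if_then_else_)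
open import Data.Bool.Properties as Bool using (¬-not)
open import Data.Empty using (⊥)
open import Data.Fin.Base
  using (Fin; zero; suc; toℕ; fromℕ; fromℕ<; inject₁; _↑ˡ_; _↑ʳ_; splitAt; combine; remQuot; punchIn)
open import Data.Fin.Patterns using (0F; 1F; 2F; 3F; 4F)
open import Data.Fin.Properties as Fin
  using (+↔⊎; *↔×; 1↔⊤; 2↔Bool; ¬∀⟶∃¬; toℕ-↑ˡ; toℕ-↑ʳ; toℕ-combine; toℕ-fromℕ<; splitAt-↑ˡ; splitAt-↑ʳ;
         remQuot-combine; combine-injectiveʳ)
open import Data.Integer.Base as ℤ using (+_; +[1+_]; +<+)
import Data.Integer.Properties as ℤ
open import Data.List.Base as List
  using (List; []; _∷_; [_]; _++_; _∷ʳ_; length; concat; concatMap; tabulate; replicate; fromMaybe)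
import Data.List.Properties as List
open import Data.Maybe.Base as Maybe using (Maybe; just; nothing; is-nothing; maybe′)
open import Data.Nat.Base as ℕ using (ℕ; zero; suc; s≤s; z≤n)
import Data.Nat.Properties as ℕ
open import Data.Nat.Solver renaming (module +-*-Solver to ℕ-Solver)
open import Data.Product.Base using (_×_; _,_; ∃-syntax; proj₁; proj₂; map₁; map₂)
open import Data.Product.Function.NonDependent.Propositional using (_×-↔_)
open import Data.Rational.Base as ℚ using (ℚ; 0ℚ; 1ℚ; ½; mkℚ; 1/_; toℚᵘ; Positive; nonNegative; positive; *<*)
open import Data.Rational.Properties as ℚ
  using (+-0-commutativeMonoid; +-*-commutativeRing; toℚᵘ-homo-*; toℚᵘ-cancel-<)
open import Data.Rational.Solver renaming (module +-*-Solver to ℚ-Solver)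
open import Data.Rational.Unnormalised.Base as ℚᵘ using (ℚᵘ)
import Data.Rational.Unnormalised.Properties as ℚᵘ
open import Data.Sum.Base using (_⊎_; inj₁; inj₂; [_,_]′)
open import Data.Sum.Function.Propositional using (_⊎-↔_)
open import Data.Unit.Base using (⊤; tt)
open import Data.Vec.Base as Vec using (Vec; []; _∷_; lookup; updateAt; _[_]≔_)
open import Data.Vec.Functional using (removeAt)
import Data.Vec.Properties as Vec
open import Function.Base using (_∘_; id)
open import Function.Bundles using (_⇔_; mk⇔; _↔_; mk↔ₛ′; Equivalence; Inverse)
open import Function.Definitions using (Injective)
open import Function.Properties.Inverse using (↔-sym; ↔-trans; ↔-refl; ↔⇒↣)
open import Relation.Binary.Definitions using (DecidableEquality)
open import Relation.Binary.PropositionalEquality hiding ([_]; J)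
open import Relation.Nullary using (Dec; does; yes; no; contradiction)
open import Relation.Nullary.Decidable using (via-injection; dec-true)

open import Defs

-- A location can hold one claim but no configuration, and the counter can only be counted and
-- tested for zero; hence the run of `M` is traced backwards, one claim at a time. As the counter is
-- unbounded, exponentially long runs need no binary clock. The machine is deterministic, so the
-- true view at each time is unique: the player's choices guess the past instead of modelling
-- nondeterminism, and a wrong guess is refuted by one of its checks. Three features of the model
-- shape the details. A claim that is false at counter zero must not win later, so its further moves
-- lead to a location outside `R` where the run stays. Successors are listed without repetition, so
-- the claims drawn from must be distinct; constant claims give a location of its own to whatever
-- the named view already settles. Finally, cells next to the head and cells at the edge of the
-- space bound have other premises than the cells between them, so they get separate templates,
-- while a single template serves all layers in between.

module Σℚ = Algebra.Properties.CommutativeMonoid.Sum +-0-commutativeMonoid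
ℚ-semiring = CommutativeRing.semiring +-*-commutativeRing

-- Finite sums and rational distributions

sum : ∀ {n} → (Fin n → ℚ) → ℚ
sum = Σℚ.sum

sum-mono-≤ : ∀ {n} {x y : Fin n → ℚ} → (∀ i → x i ℚ.≤ y i) → sum x ℚ.≤ sum y
sum-mono-≤ {zero}  x≤y = ℚ.≤-refl
sum-mono-≤ {suc n} x≤y = ℚ.+-mono-≤ (x≤y zero) (sum-mono-≤ (x≤y ∘ suc))

0≤sum : ∀ {n} {x : Fin n → ℚ} → (∀ i → 0ℚ ℚ.≤ x i) → 0ℚ ℚ.≤ sum x
0≤sum {zero}  0≤x = ℚ.≤-refl
0≤sum {suc n} 0≤x = ℚ.+-mono-≤ (0≤x zero) (0≤sum (0≤x ∘ suc))

*-mono-nonNeg : ∀ {w x y} → 0ℚ ℚ.≤ w → x ℚ.≤ y → w ℚ.* x ℚ.≤ w ℚ.* y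
*-mono-nonNeg {w} 0≤w = ℚ.*-monoˡ-≤-nonNeg w {{nonNegative 0≤w}}

mean : ∀ {n} → Dist n → (Fin n → ℚ) → ℚ
mean d x = sum λ i → weight d i ℚ.* x i

module _ {n} (d : Dist n) where

  mean-mono : ∀ {x y} → (∀ i → x i ℚ.≤ y i) → mean d x ℚ.≤ mean d y
  mean-mono x≤y = sum-mono-≤ λ i → *-mono-nonNeg (0≤w d i) (x≤y i)

  mean-const : ∀ c → mean d (λ _ → c) ≡ c
  mean-const c = begin
    mean d (λ _ → c)      ≡⟨ *-distribʳ-sum ℚ-semiring c (weight d) ⟨
    sum (weight d) ℚ.* c  ≡⟨ cong (ℚ._* c) (sum≡1 d) ⟩
    1ℚ ℚ.* c              ≡⟨ ℚ.*-identityˡ c ⟩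
    c                     ∎
    where open ≡-Reasoning

  mean-+ : ∀ x c → mean d x ℚ.+ c ≡ mean d (λ i → x i ℚ.+ c)
  mean-+ x c = begin
    mean d x ℚ.+ c                                   ≡⟨ cong (mean d x ℚ.+_) (mean-const c) ⟨
    mean d x ℚ.+ mean d (λ _ → c)                    ≡⟨ Σℚ.∑-distrib-+ (λ i →
      weight d i ℚ.* x i) _ ⟨
    sum (λ i → weight d i ℚ.* x i ℚ.+ weight d i ℚ.* c)
      ≡⟨ Σℚ.sum-cong-≗ (λ i → sym (ℚ.*-distribˡ-+ (weight d i) (x i) c)) ⟩
    mean d (λ i → x i ℚ.+ c)                         ∎
    where open ≡-Reasoning

  -- Upper bounds on winning probabilities are carried as `x + e ≤ 1`: a common deficit `e` then
  -- passes through any average, in particular through a randomised choice of the player, without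
  -- subtraction.
  mean-deficit : ∀ {x e} → (∀ i → x i ℚ.+ e ℚ.≤ 1ℚ) → mean d x ℚ.+ e ℚ.≤ 1ℚ
  mean-deficit {x} {e} h = begin
    mean d x ℚ.+ e            ≡⟨ mean-+ x e ⟩
    mean d (λ i → x i ℚ.+ e)  ≤⟨ mean-mono h ⟩
    mean d (λ _ → 1ℚ)         ≡⟨ mean-const 1ℚ ⟩
    1ℚ                        ∎
    where open ℚ.≤-Reasoning

-- All other values are at most 1, so the deficit of one outcome survives in the mean, scaled by the
-- weight of that outcome. One refuting branch is therefore enough.
mean-deficit-at : ∀ {n} (d : Dist n) {x e} i → (∀ j → x j ℚ.≤ 1ℚ) → x i ℚ.+ e ℚ.≤ 1ℚ →
                  mean d x ℚ.+ weight d i ℚ.* e ℚ.≤ 1ℚ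
mean-deficit-at {suc n} d {x} {e} i x≤1 h = begin
  mean d x ℚ.+ w i ℚ.* e
    ≡⟨ cong (ℚ._+ w i ℚ.* e) (Σℚ.sum-remove {i = i} wx) ⟩
  (w i ℚ.* x i ℚ.+ sum (removeAt wx i)) ℚ.+ w i ℚ.* e
    ≡⟨ solve 4 (λ a b c s → (a :* b :+ s) :+ a :* c := a :* (b :+ c) :+ s) refl
         (w i) (x i) e (sum (removeAt wx i)) ⟩
  w i ℚ.* (x i ℚ.+ e) ℚ.+ sum (removeAt wx i)
    ≤⟨ ℚ.+-mono-≤ (*-mono-nonNeg (0≤w d i) h)
         (sum-mono-≤ {n} λ j → *-mono-nonNeg (0≤w d (punchIn i j)) (x≤1 (punchIn i j))) ⟩
  w i ℚ.* 1ℚ ℚ.+ sum (removeAt (λ j → w j ℚ.* 1ℚ) i)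
    ≡⟨ Σℚ.sum-remove {i = i} (λ j → w j ℚ.* 1ℚ) ⟨
  mean d (λ _ → 1ℚ)
    ≡⟨ mean-const d 1ℚ ⟩
  1ℚ ∎
  where
  open ℚ.≤-Reasoning
  open ℚ-Solver
  w  = weight d
  wx = λ j → w j ℚ.* x j

0≤1 : 0ℚ ℚ.≤ 1ℚ
0≤1 = ℚ.nonNegative⁻¹ 1ℚ

-- The natural number `n` as a rational; written as a sum, it makes the equal weights add up to 1 by
-- distributivity.
ones : ℕ → ℚ
ones n = sum {n} λ _ → 1ℚ

0<ones : ∀ n → 0ℚ ℚ.< ones (suc n)
0<ones n = ℚ.+-mono-<-≤ (ℚ.positive⁻¹ 1ℚ) (0≤sum {n} λ _ → 0≤1)

module _ (n : ℕ) where
  private instance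
    ones-positive : Positive (ones (suc n))
    ones-positive = positive (0<ones n)

    ones-nonZero : ℚ.NonZero (ones (suc n))
    ones-nonZero = ℚ.pos⇒nonZero (ones (suc n))

  share : ℚ
  share = 1/ ones (suc n)

  0<share : 0ℚ ℚ.< share
  0<share = ℚ.positive⁻¹ share {{ℚ.1/pos⇒pos (ones (suc n))}}

  sum-share : sum {suc n} (λ _ → share) ≡ 1ℚ
  sum-share = begin
    sum {suc n} (λ _ → share)           ≡⟨ Σℚ.sum-cong-≗ {suc n} (λ _ → sym (ℚ.*-identityˡ share)) ⟩
    sum {suc n} (λ _ → 1ℚ ℚ.* share)    ≡⟨ *-distribʳ-sum ℚ-semiring {suc n} share (λ _ → 1ℚ) ⟨
    ones (suc n) ℚ.* share              ≡⟨ ℚ.*-inverseʳ (ones (suc n)) ⟩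
    1ℚ                                  ∎
    where open ≡-Reasoning

  uniform : Dist (suc n)
  uniform = record
    { weight = λ _ → share
    ; 0≤w    = λ _ → ℚ.<⇒≤ 0<share
    ; w≤1    = λ _ → begin
        share                                ≡⟨ ℚ.+-identityʳ share ⟨
        share ℚ.+ 0ℚ                         ≤⟨ ℚ.+-monoʳ-≤ share (0≤sum {n} λ _ → ℚ.<⇒≤ 0<share) ⟩
        share ℚ.+ sum {n} (λ _ → share)      ≡⟨ sum-share ⟩
        1ℚ                                   ∎
    ; sum≡1  = sum-share
    }
    where open ℚ.≤-Reasoning

diracWeight : ∀ {n} → Fin n → Fin n → ℚ
diracWeight zero    zero    = 1ℚ
diracWeight zero    (suc _) = 0ℚ
diracWeight (suc _) zero    = 0ℚ
diracWeight (suc i) (suc j) = diracWeight i j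

mean-dirac : ∀ {n} (i : Fin n) (x : Fin n → ℚ) → sum (λ j → diracWeight i j ℚ.* x j) ≡ x i
mean-dirac {suc n} zero x = begin
  1ℚ ℚ.* x zero ℚ.+ sum (λ j → 0ℚ ℚ.* x (suc j))
    ≡⟨ cong₂ ℚ._+_ (ℚ.*-identityˡ (x zero))
         (trans (Σℚ.sum-cong-≗ {n} (λ j → ℚ.*-zeroˡ (x (suc j)))) (Σℚ.sum-replicate-zero n)) ⟩
  x zero ℚ.+ 0ℚ
    ≡⟨ ℚ.+-identityʳ (x zero) ⟩
  x zero ∎
  where open ≡-Reasoning
mean-dirac {suc n} (suc i) x =
  trans (cong₂ ℚ._+_ (ℚ.*-zeroˡ (x zero)) (mean-dirac i (x ∘ suc))) (ℚ.+-identityˡ _)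

dirac : ∀ {n} → Fin n → Dist n
dirac i = record
  { weight = diracWeight i
  ; 0≤w    = 0≤dirac i
  ; w≤1    = dirac≤1 i
  ; sum≡1  = trans (Σℚ.sum-cong-≗ (λ j → sym (ℚ.*-identityʳ (diracWeight i j)))) (mean-dirac i λ _ →
    1ℚ)
  }
  where
  0≤dirac : ∀ {n} (i j : Fin n) → 0ℚ ℚ.≤ diracWeight i j
  0≤dirac zero    zero    = 0≤1
  0≤dirac zero    (suc _) = ℚ.≤-refl
  0≤dirac (suc _) zero    = ℚ.≤-refl
  0≤dirac (suc i) (suc j) = 0≤dirac i j

  dirac≤1 : ∀ {n} (i j : Fin n) → diracWeight i j ℚ.≤ 1ℚ
  dirac≤1 zero    zero    = ℚ.≤-refl
  dirac≤1 zero    (suc _) = 0≤1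
  dirac≤1 (suc _) zero    = 0≤1
  dirac≤1 (suc i) (suc j) = dirac≤1 i j

pow : ℚ → ℕ → ℚ
pow c zero    = 1ℚ
pow c (suc t) = c ℚ.* pow c t

0<pow : ∀ {c} → 0ℚ ℚ.< c → ∀ t → 0ℚ ℚ.< pow c t
0<pow 0<c zero    = ℚ.positive⁻¹ 1ℚ
0<pow {c} 0<c (suc t) = begin-strict
  0ℚ             ≡⟨ ℚ.*-zeroʳ c ⟨
  c ℚ.* 0ℚ       <⟨ ℚ.*-monoʳ-<-pos c {{positive 0<c}} (0<pow 0<c t) ⟩
  c ℚ.* pow c t  ∎
  where open ℚ.≤-Reasoning

-- For d = p/q the exponent q suffices, because q < 2^q gives 1/2^q < 1/q ≤ p/q. Unnormalised
-- rationals are convenient here: halving keeps the numerator 1 and doubles the denominator.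
archimedean : ∀ {d} → 0ℚ ℚ.< d → ∃[ t ] pow ½ t ℚ.< d
archimedean {mkℚ (+ zero)  _   _} (*<* (+<+ ()))
archimedean {d@(mkℚ +[1+ p ] q-1 _)} _ =
  suc q-1 , toℚᵘ-cancel-< (ℚᵘ.<-respˡ-≃ (ℚᵘ.≃-sym (pow½ (suc q-1))) small)
  where
  2^ : ℕ → ℕ
  2^ zero    = 1
  2^ (suc t) = 2 ℕ.* 2^ t

  half^ : ℕ → ℚᵘ
  half^ zero    = ℚᵘ.1ℚᵘ
  half^ (suc t) = ℚᵘ.½ ℚᵘ.* half^ t

  ↥-½* : ∀ x → ℚᵘ.↥ (ℚᵘ.½ ℚᵘ.* x) ≡ + 1 ℤ.* ℚᵘ.↥ x
  ↥-½* record{} = refl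

  ↧-½* : ∀ x → ℚᵘ.↧ₙ (ℚᵘ.½ ℚᵘ.* x) ≡ 2 ℕ.* ℚᵘ.↧ₙ x
  ↧-½* record{} = refl

  numerator : ∀ t → ℚᵘ.↥ half^ t ≡ + 1
  numerator zero    = refl
  numerator (suc t) = trans (↥-½* (half^ t)) (trans (ℤ.*-identityˡ _) (numerator t))

  denominator : ∀ t → ℚᵘ.↧ₙ half^ t ≡ 2^ t
  denominator zero    = refl
  denominator (suc t) = trans (↧-½* (half^ t)) (cong (2 ℕ.*_) (denominator t))

  pow½ : ∀ t → toℚᵘ (pow ½ t) ℚᵘ.≃ half^ t
  pow½ zero    = ℚᵘ.≃-refl
  pow½ (suc t) = ℚᵘ.≃-trans (toℚᵘ-homo-* ½ (pow ½ t)) (ℚᵘ.*-congˡ {ℚᵘ.½} (pow½ t))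

  t<2^t : ∀ t → t ℕ.< 2^ t
  t<2^t zero    = s≤s z≤n
  t<2^t (suc t) = ℕ.+-mono-≤ (ℕ.≤-trans (s≤s z≤n) (t<2^t t)) (ℕ.≤-trans (t<2^t t) (ℕ.m≤m+n _ 0))

  small : half^ (suc q-1) ℚᵘ.< toℚᵘ d
  small = ℚᵘ.*<* (subst₂ ℤ._<_
    (cong (ℤ._* + suc q-1) (sym (numerator (suc q-1))))
    (trans (ℤ.pos-* (suc p) (2^ (suc q-1)))
      (cong (λ x → + suc p ℤ.* + x) (sym (denominator (suc q-1)))))
    (ℤ.<-≤-trans (subst (ℤ._< + 2^ (suc q-1)) (sym (ℤ.*-identityˡ (+ suc q-1)))
      (+<+ (t<2^t (suc q-1))))
       (ℤ.+≤+ (ℕ.m≤m+n _ (p ℕ.* 2^ (suc q-1))))))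

-- Reachability in Markov chains and in the OC-MDP of an automaton

module _ (𝓒 : MarkovChain) (T : MarkovChain.State 𝓒 → Bool) where
  open MarkovChain 𝓒

  reachWithin-nonNeg : ∀ N s → 0ℚ ℚ.≤ reachWithin T N s
  reachWithin-nonNeg zero s with T s
  ... | true  = 0≤1
  ... | false = ℚ.≤-refl
  reachWithin-nonNeg (suc N) s with T s
  ... | true  = 0≤1
  ... | false = subst (ℚ._≤ mean (prob s) x) (mean-const (prob s) 0ℚ)
                  (mean-mono (prob s) {y = x} λ i → reachWithin-nonNeg N (at (next s) i))
    where x = λ i → reachWithin T N (at (next s) i)

  reachWithin≤1 : ∀ N s → reachWithin T N s ℚ.≤ 1ℚ
  reachWithin≤1 zero s with T s
  ... | true  = ℚ.≤-refl
  ... | false = 0≤1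
  reachWithin≤1 (suc N) s with T s
  ... | true  = ℚ.≤-refl
  ... | false = subst (mean (prob s) x ℚ.≤_) (mean-const (prob s) 1ℚ)
                  (mean-mono (prob s) {x = x} λ i → reachWithin≤1 N (at (next s) i))
    where x = λ i → reachWithin T N (at (next s) i)

-- An alternating automaton over a one-letter alphabet: the atom α holds at
-- height suc n iff for some v all the atoms pred α v κ hold at height n.
record Automaton : Set where
  field
    A V K          : ℕ
    pred           : Fin A → Fin (suc V) → Fin (suc K) → Fin A
    pred-injective : ∀ α v → Injective _≡_ _≡_ (pred α v)
    base           : Fin A → Bool
    sink ok        : Fin A

module Game (𝓐 : Automaton) where
  open Automaton 𝓐

  -- The left summand consists of the atoms. On the right, `zero` is the starting location and
  -- `suc (combine α v)` is the atom `α` after the choice `v`.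
  Loc : Set
  Loc = Fin A ⊎ Fin (suc (A ℕ.* suc V))

  only : {B : Set} → B → FinSet⁺ B
  only b = record { size-1 = 0 ; at = λ _ → b ; at-injective = λ { {0F} {0F} _ → refl } }

  -- For atoms and choice locations at counter 0. The verdict on an atom falls on arrival there;
  -- afterwards the run stays in `sink`, whose `base` will be assumed false, and cannot win any
  -- more.
  toSink : FinSet⁺ (Step₀ × Loc)
  toSink = only (stay , inj₁ sink)

  startMoves : {S : Set} → S → S → FinSet⁺ (S × Loc)
  startMoves up′ stay′ = record
    { size-1       = 1
    ; at           = λ { 0F → up′ , inj₂ 0F ; 1F → stay′ , inj₁ ok }
    ; at-injective = λ { {0F} {0F} _ → refl ; {0F} {1F} () ; {1F} {0F} () ; {1F} {1F} _ → refl }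
    }

  choices : Fin A → FinSet⁺ (Step₊ × Loc)
  choices α = record
    { size-1       = V
    ; at           = λ v → stay , inj₂ (suc (combine α v))
    ; at-injective = λ { {v} {v′} eq → combine-injectiveʳ α v α v′ (suc-inj₂ (cong proj₂ eq)) }
    }
    where
    suc-inj₂ : ∀ {i j : Fin (A ℕ.* suc V)} → _≡_ {A = Loc} (inj₂ (suc i)) (inj₂ (suc j)) → i ≡ j
    suc-inj₂ refl = refl

  -- Distinct demands must be distinct successors, which is the reason for requiring
  -- `pred-injective`.
  demands : Fin A × Fin (suc V) → FinSet⁺ (Step₊ × Loc)
  demands (α , v) = record
    { size-1       = K
    ; at           = λ κ → down , inj₁ (pred α v κ)
    ; at-injective = λ eq → pred-injective α v (inj₁-inj (cong proj₂ eq))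
    }
    where
    inj₁-inj : ∀ {i j : Fin A} → _≡_ {A = Loc} (inj₁ i) (inj₁ j) → i ≡ j
    inj₁-inj refl = refl

  ocmdp : OC-MDP
  ocmdp = record
    { #N = A
    ; #P = suc (A ℕ.* suc V)
    ; δ₀ = λ { (inj₁ _) → toSink ; (inj₂ zero) → startMoves up stay ; (inj₂ (suc _)) → toSink }
    ; δ₊ = λ { (inj₁ α) → choices α ; (inj₂ zero) → startMoves up stay
             ; (inj₂ (suc m)) → demands (remQuot (suc V) m) }
    ; f₀ = λ { zero → uniform 1 ; (suc _) → uniform 0 }
    ; f₊ = λ { zero → uniform 1 ; (suc _) → uniform K }
    }

  target₀ : Loc → Bool
  target₀ (inj₁ α) = base α
  target₀ (inj₂ _) = false

  gameInstance : ValOneInstance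
  gameInstance = record { A = ocmdp ; R = target₀ ; q = inj₂ zero }

  open OC-MDP ocmdp using (mdp; config; inZero; ValOne)

  T : MDP.V mdp → Bool
  T v = inZero target₀ (config v)

  module _ (σ : MDP.Strategy mdp) where
    reach : ℕ → List (MDP.V mdp) → MDP.V mdp → ℚ
    reach N w v = MarkovChain.reachWithin (MDP.chain mdp σ) (λ { (_ , u) → T u }) N (w , v)

    reach≤1 : ∀ N w v → reach N w v ℚ.≤ 1ℚ
    reach≤1 N w v = reachWithin≤1 (MDP.chain mdp σ) _ N (w , v)

  -- H n α is the truth value of α at height n.
  module _ (H : ℕ → Fin A → Bool)
           (H-base : ∀ α → H 0 α ≡ base α)
           (sink-false : base sink ≡ false)
           (win  : ∀ n α → H (suc n) α ≡ true → ∃[ v ] ∀ κ → H n (pred α v κ) ≡ true)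
           (lose : ∀ n α → H (suc n) α ≡ false → ∀ v → ∃[ κ ] H n (pred α v κ) ≡ false)
    where

    choice : ∀ n α → ∃[ v ] (H (suc n) α ≡ true → ∀ κ → H n (pred α v κ) ≡ true)
    choice n α with H (suc n) α in eq
    ... | true  = let v , h = win n α eq in v , λ _ → h
    -- A strategy must be defined everywhere; for a false atom any choice will do.
    ... | false = zero , λ ()

    truthful : MDP.Strategy mdp
    truthful _ (α , zero)  = uniform 0
    truthful _ (α , suc n) = dirac (proj₁ (choice n α))

    -- Each height costs two moves, a choice and a demand. The slack `N` changes nothing, as a run
    -- that has arrived in the target already counts fully.
    reach-true : ∀ n α w N → H n α ≡ true → reach truthful (n ℕ.+ n ℕ.+ N) w (inj₁ (α , n)) ≡ 1ℚ
    reach-true zero α w zero    h rewrite sym (H-base α) | h = refl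
    reach-true zero α w (suc N) h rewrite sym (H-base α) | h = refl
    reach-true (suc n) α w N h rewrite ℕ.+-suc n n = begin
      mean (dirac v) (λ v →
        reach truthful (suc (n ℕ.+ n ℕ.+ N)) w₁ (inj₂ (suc (combine α v) , suc n)))
        ≡⟨ mean-dirac v (λ v →
          reach truthful (suc (n ℕ.+ n ℕ.+ N)) w₁ (inj₂ (suc (combine α v) , suc n))) ⟩
      reach truthful (suc (n ℕ.+ n ℕ.+ N)) w₁ (inj₂ (suc (combine α v) , suc n))
        ≡⟨ Σℚ.sum-cong-≗ {suc K} (λ κ → cong (share K ℚ.*_)
             (trans (cong (λ x → reach truthful (n ℕ.+ n ℕ.+ N) w₂
               (inj₁ (pred (proj₁ x) (proj₂ x) κ , n)))
                       (remQuot-combine α v))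
                    (reach-true n _ w₂ N (proj₂ (choice n α) h κ)))) ⟩
      mean (uniform K) (λ _ → 1ℚ)
        ≡⟨ mean-const (uniform K) 1ℚ ⟩
      1ℚ ∎
      where
      open ≡-Reasoning
      v  = proj₁ (choice n α)
      w₁ = w ∷ʳ inj₁ (α , suc n)
      w₂ = w₁ ∷ʳ inj₂ (suc (combine α v) , suc n)

    -- The loss `pow ½ t` is the probability of still climbing after `t` tosses. A stop before that
    -- happens below height `t + n`, where `M` leaves enough moves to settle the claim. Since
    -- `t + n` is constant along the induction, `M` can stay fixed.
    start-lower : (∀ n → H n ok ≡ true) → ∀ t n w M → (t ℕ.+ n) ℕ.+ (t ℕ.+ n) ℕ.≤ M →
                  1ℚ ℚ.≤ reach truthful (t ℕ.+ M) w (inj₂ (zero , n)) ℚ.+ pow ½ t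
    start-lower all zero    n w M _ =
      ℚ.+-mono-≤ (reachWithin-nonNeg (MDP.chain mdp truthful) _ M (w , inj₂ (zero , n))) ℚ.≤-refl
    start-lower all (suc t) n w M h = begin
      1ℚ
        ≡⟨⟩
      ½ ℚ.* 1ℚ ℚ.+ ½
        ≤⟨ ℚ.+-monoˡ-≤ ½ (*-mono-nonNeg (ℚ.nonNegative⁻¹ ½)
             (start-lower all t (suc n) w₁ M
               (subst (ℕ._≤ M) (cong₂ ℕ._+_ (sym (ℕ.+-suc t n)) (sym (ℕ.+-suc t n))) h))) ⟩
      ½ ℚ.* (x ℚ.+ pow ½ t) ℚ.+ ½
        ≡⟨ solve 2 (λ a b → con ½ :* (a :+ b) :+ con ½ :=
          (con ½ :* a :+ (con ½ :* con 1ℚ :+ con 0ℚ)) :+ con ½ :* b) refl x (pow ½ t) ⟩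
      (½ ℚ.* x ℚ.+ (½ ℚ.* 1ℚ ℚ.+ 0ℚ)) ℚ.+ ½ ℚ.* pow ½ t
        ≡⟨ cong (λ y → (½ ℚ.* x ℚ.+ (½ ℚ.* y ℚ.+ 0ℚ)) ℚ.+ ½ ℚ.* pow ½ t) (sym reach-ok) ⟩
      mean (uniform 1) (λ { 0F → x ; 1F → y }) ℚ.+ ½ ℚ.* pow ½ t
        ≡⟨ cong (ℚ._+ ½ ℚ.* pow ½ t) (sym (unfold n)) ⟩
      reach truthful (suc t ℕ.+ M) w (inj₂ (zero , n)) ℚ.+ pow ½ (suc t) ∎
      where
      open ℚ.≤-Reasoning
      open ℚ-Solver
      w₁ = w ∷ʳ inj₂ (zero , n)
      x  = reach truthful (t ℕ.+ M) w₁ (inj₂ (zero , suc n))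
      y  = reach truthful (t ℕ.+ M) w₁ (inj₁ (ok , n))

      unfold : ∀ n → let w₁ = w ∷ʳ inj₂ (zero , n) in
        reach truthful (suc t ℕ.+ M) w (inj₂ (zero , n)) ≡
        mean (uniform 1) (λ { 0F → reach truthful (t ℕ.+ M) w₁ (inj₂ (zero , suc n))
                            ; 1F → reach truthful (t ℕ.+ M) w₁ (inj₁ (ok , n)) })
      unfold zero    = refl
      unfold (suc n) = refl

      2n≤ : n ℕ.+ n ℕ.≤ t ℕ.+ M
      2n≤ = ℕ.≤-trans (ℕ.+-mono-≤ (ℕ.m≤n+m n (suc t)) (ℕ.m≤n+m n (suc t)))
        (ℕ.≤-trans h (ℕ.m≤n+m M t))

      reach-ok : y ≡ 1ℚ
      reach-ok = trans (cong (λ N → reach truthful N w₁ (inj₁ (ok , n))) (sym (ℕ.m+[n∸m]≡n 2n≤)))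
                       (reach-true n ok w₁ (t ℕ.+ M ℕ.∸ (n ℕ.+ n)) (all n))

    always⇒ValOne : (∀ n → H n ok ≡ true) → ValOne target₀ (inj₂ zero , 0)
    always⇒ValOne all r = mk⇔ (λ { (σ , N , r<x) → ℚ.<-≤-trans r<x (reach≤1 σ N [] _) }) λ r<1 →
      -- Only the horizon depends on `r`, not the strategy: `t` is chosen with `pow ½ t` below
      -- `1 - r`.
      let t , h = archimedean (subst (ℚ._< 1ℚ ℚ.- r) (ℚ.+-inverseʳ r) (ℚ.+-monoˡ-< (ℚ.- r) r<1))
          M     = (t ℕ.+ 0) ℕ.+ (t ℕ.+ 0)
          x     = reach truthful (t ℕ.+ M) [] (inj₂ (zero , 0))
          open ℚ.≤-Reasoning
          open ℚ-Solver
      in truthful , t ℕ.+ M , (begin-strict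
        r                                            ≡⟨ solve 2 (λ r p →
          r := (r :+ p) :+ :- p) refl r (pow ½ t) ⟩
        (r ℚ.+ pow ½ t) ℚ.- pow ½ t                  <⟨ ℚ.+-monoˡ-< (ℚ.- pow ½ t)
          (ℚ.+-monoʳ-< r h) ⟩
        (r ℚ.+ (1ℚ ℚ.- r)) ℚ.- pow ½ t               ≡⟨ cong (ℚ._- pow ½ t)
          (solve 1 (λ r → r :+ (con 1ℚ :+ :- r) := con 1ℚ) refl r) ⟩
        1ℚ ℚ.- pow ½ t                               ≤⟨ ℚ.+-monoˡ-≤ (ℚ.- pow ½ t)
          (start-lower all t 0 [] M ℕ.≤-refl) ⟩
        (x ℚ.+ pow ½ t) ℚ.- pow ½ t                  ≡⟨ solve 2 (λ x p →
          (x :+ p) :+ :- p := x) refl x (pow ½ t) ⟩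
        x                                            ∎)

    module _ (σ : MDP.Strategy mdp) where

      reach-sink : ∀ N w → reach σ N w (inj₁ (sink , 0)) ≡ 0ℚ
      reach-sink zero    w rewrite sink-false = refl
      reach-sink (suc N) w rewrite sink-false = trans
        (Σℚ.sum-cong-≗ {1} (λ i →
          cong (weight (σ w (sink , 0)) i ℚ.*_) (reach-sink N (w ∷ʳ inj₁ (sink , 0)))))
        (mean-const (σ w (sink , 0)) 0ℚ)

      ε : ℕ → ℚ
      ε = pow (share K)

      share≤1 : ∀ n → share n ℚ.≤ 1ℚ
      share≤1 n = w≤1 (uniform n) zero

      pow≤1 : ∀ {c} → 0ℚ ℚ.≤ c → c ℚ.≤ 1ℚ → ∀ t → pow c t ℚ.≤ 1ℚ
      pow≤1 0≤c c≤1 zero    = ℚ.≤-refl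
      pow≤1 {c} 0≤c c≤1 (suc t) =
        ℚ.≤-trans (*-mono-nonNeg 0≤c (pow≤1 0≤c c≤1 t))
        (subst (ℚ._≤ 1ℚ) (sym (ℚ.*-identityʳ c)) c≤1)

      ε≤1 : ∀ n → 0ℚ ℚ.+ ε n ℚ.≤ 1ℚ
      ε≤1 n = subst (ℚ._≤ 1ℚ) (sym (ℚ.+-identityˡ (ε n))) (pow≤1 (ℚ.<⇒≤ (0<share K)) (share≤1 K) n)

      -- Whatever the strategy mixes, each choice has a false demand, drawn with probability
      -- `share K`; the deficit shrinks by this factor per height, starting from 1 at counter 0. The
      -- case split on the number of moves goes in steps of two because a height takes two moves.
      reach-false : ∀ n α w N → H n α ≡ false → reach σ N w (inj₁ (α , n)) ℚ.+ ε n ℚ.≤ 1ℚ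
      reach-false zero α w zero h rewrite trans (sym (H-base α)) h = ℚ.≤-refl
      reach-false zero α w (suc N) h rewrite trans (sym (H-base α)) h =
        mean-deficit (σ w (α , 0)) {λ _ → reach σ N w₁ (inj₁ (sink , 0))} λ _ →
          ℚ.≤-reflexive (cong (ℚ._+ 1ℚ) (reach-sink N w₁))
        where w₁ = w ∷ʳ inj₁ (α , 0)
      -- With fewer than two moves left, counter 0 is out of reach and the probability is 0.
      reach-false (suc n) α w zero    h = ε≤1 (suc n)
      reach-false (suc n) α w (suc zero) h =
        mean-deficit (σ w (α , suc n)) {λ _ → 0ℚ} λ v → ε≤1 (suc n)
      reach-false (suc n) α w (suc (suc N)) h =
        mean-deficit (σ w (α , suc n)) {λ v → mean (uniform K) (after v)} λ v →
          let κ , h′ = lose n α h v in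
          mean-deficit-at (uniform K) {after v} κ
            (λ κ → reach≤1 σ N (w₂ v) (inj₁ (demanded (remQuot (suc V) (combine α v)) κ , n)))
            (subst (λ x → reach σ N (w₂ v) (inj₁ (demanded x κ , n)) ℚ.+ ε n ℚ.≤ 1ℚ)
              (sym (remQuot-combine α v)) (reach-false n (pred α v κ) (w₂ v) N h′))
        where
        w₂ : Fin (suc V) → List (MDP.V mdp)
        w₂ v = (w ∷ʳ inj₁ (α , suc n)) ∷ʳ inj₂ (suc (combine α v) , suc n)

        demanded : Fin A × Fin (suc V) → Fin (suc K) → Fin A
        demanded (α , v) = pred α v

        after : Fin (suc V) → Fin (suc K) → ℚ
        after v κ = reach σ N (w₂ v) (inj₁ (demanded (remQuot (suc V) (combine α v)) κ , n))

      -- The factor `pow ½ (suc d)` is the probability of `d` climbs followed by a stop, which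
      -- commits the player to the false claim at height `d + n`.
      start-upper : ∀ d n w N → H (d ℕ.+ n) ok ≡ false →
                    reach σ N w (inj₂ (zero , n)) ℚ.+ pow ½ (suc d) ℚ.* ε (d ℕ.+ n) ℚ.≤ 1ℚ
      start-upper d n w zero h = lem n
        where
        e≤1 : 0ℚ ℚ.+ pow ½ (suc d) ℚ.* ε (d ℕ.+ n) ℚ.≤ 1ℚ
        e≤1 = begin
          0ℚ ℚ.+ pow ½ (suc d) ℚ.* ε (d ℕ.+ n) ≡⟨ ℚ.+-identityˡ _ ⟩
          pow ½ (suc d) ℚ.* ε (d ℕ.+ n)        ≤⟨ *-mono-nonNeg
            (ℚ.<⇒≤ (0<pow (ℚ.positive⁻¹ ½) (suc d)))
                                                     (pow≤1 (ℚ.<⇒≤ (0<share K)) (share≤1 K)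
                                                       (d ℕ.+ n)) ⟩
          pow ½ (suc d) ℚ.* 1ℚ                 ≡⟨ ℚ.*-identityʳ _ ⟩
          pow ½ (suc d)                        ≤⟨ pow≤1 (ℚ.nonNegative⁻¹ ½) (share≤1 1) (suc d) ⟩
          1ℚ                                   ∎
          where open ℚ.≤-Reasoning

        lem : ∀ m → reach σ 0 w (inj₂ (zero , m)) ℚ.+ pow ½ (suc d) ℚ.* ε (d ℕ.+ n) ℚ.≤ 1ℚ
        lem zero    = e≤1
        lem (suc _) = e≤1
      start-upper d n w (suc N) h =
        subst₂ (λ x e → x ℚ.+ e ℚ.≤ 1ℚ) (sym (unfold n)) (sym (ℚ.*-assoc ½ (pow ½ d) _)) (bound d h)
        where
        w₁ = w ∷ʳ inj₂ (zero , n)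

        next₂ : ℕ → Fin 2 → ℚ
        next₂ n 0F = reach σ N (w ∷ʳ inj₂ (zero , n)) (inj₂ (zero , suc n))
        next₂ n 1F = reach σ N (w ∷ʳ inj₂ (zero , n)) (inj₁ (ok , n))

        unfold : ∀ n → reach σ (suc N) w (inj₂ (zero , n)) ≡ mean (uniform 1) (next₂ n)
        unfold zero    = refl
        unfold (suc n) = refl

        next₂≤1 : ∀ i → next₂ n i ℚ.≤ 1ℚ
        next₂≤1 0F = reach≤1 σ N _ _
        next₂≤1 1F = reach≤1 σ N _ _

        bound : ∀ d → H (d ℕ.+ n) ok ≡ false →
                mean (uniform 1) (next₂ n) ℚ.+ ½ ℚ.* (pow ½ d ℚ.* ε (d ℕ.+ n)) ℚ.≤ 1ℚ
        bound zero    h = mean-deficit-at (uniform 1) {next₂ n} 1F next₂≤1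
          (subst (λ e → next₂ n 1F ℚ.+ e ℚ.≤ 1ℚ) (sym (ℚ.*-identityˡ (ε n)))
            (reach-false n ok w₁ N h))
        bound (suc d) h = mean-deficit-at (uniform 1) {next₂ n} 0F next₂≤1
          (subst (λ m → next₂ n 0F ℚ.+ pow ½ (suc d) ℚ.* ε m ℚ.≤ 1ℚ) (ℕ.+-suc d n)
            (start-upper d (suc n) w₁ N (trans (cong (λ m → H m ok) (ℕ.+-suc d n)) h)))

    -- The deficit `e` depends on `n` but not on the strategy. A value of one would provide a
    -- strategy exceeding the rational `1 - e`, which none does.
    ValOne⇒always : ValOne target₀ (inj₂ zero , 0) → ∀ n → H n ok ≡ true
    ValOne⇒always val n with H n ok in eq
    ... | true  = refl
    ... | false = contradiction (ℚ.<-≤-trans 1<x+e x+e≤1) (ℚ.<-irrefl refl)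
      where
      e = pow ½ (suc n) ℚ.* pow (share K) n

      0<e : 0ℚ ℚ.< e
      0<e = subst (ℚ._< e) (ℚ.*-zeroʳ (pow ½ (suc n)))
        (ℚ.*-monoʳ-<-pos (pow ½ (suc n)) {{positive (0<pow (ℚ.positive⁻¹ ½) (suc n))}}
          (0<pow (0<share K) n))

      r = 1ℚ ℚ.- e

      r+e : r ℚ.+ e ≡ 1ℚ
      r+e = solve 1 (λ e → (con 1ℚ :+ :- e) :+ e := con 1ℚ) refl e
        where open ℚ-Solver

      r<1 : r ℚ.< 1ℚ
      r<1 = subst₂ ℚ._<_ (ℚ.+-identityʳ r) r+e (ℚ.+-monoʳ-< r 0<e)

      beaten = Equivalence.from (val r) r<1
      σ = proj₁ beaten
      N = proj₁ (proj₂ beaten)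
      x = reach σ N [] (inj₂ (zero , 0))

      1<x+e : 1ℚ ℚ.< x ℚ.+ e
      1<x+e = subst (ℚ._< x ℚ.+ e) r+e (ℚ.+-monoˡ-< e (proj₂ (proj₂ beaten)))

      x+e≤1 : x ℚ.+ e ℚ.≤ 1ℚ
      x+e≤1 = subst (λ m → x ℚ.+ pow ½ (suc n) ℚ.* pow (share K) m ℚ.≤ 1ℚ) (ℕ.+-identityʳ n)
        (start-upper σ n 0 [] N (trans (cong (λ m → H m ok) (ℕ.+-identityʳ n)) eq))

-- Finite types

⊤-finite : Finite ⊤
⊤-finite = 1 , ↔-sym 1↔⊤

Bool-finite : Finite Bool
Bool-finite = 2 , ↔-sym 2↔Bool

Fin-finite : ∀ n → Finite (Fin n)
Fin-finite n = n , ↔-refl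

_⊎-finite_ : ∀ {A B} → Finite A → Finite B → Finite (A ⊎ B)
(m , a) ⊎-finite (n , b) = m ℕ.+ n , ↔-trans (a ⊎-↔ b) (↔-sym +↔⊎)

_×-finite_ : ∀ {A B} → Finite A → Finite B → Finite (A × B)
(m , a) ×-finite (n , b) = m ℕ.* n , ↔-trans (a ×-↔ b) (↔-sym *↔×)

↔-finite : ∀ {A B} → A ↔ B → Finite B → Finite A
↔-finite a (n , b) = n , ↔-trans a b

Maybe-finite : ∀ {A} → Finite A → Finite (Maybe A)
Maybe-finite {A} fin = ↔-finite (mk↔ₛ′ to from to∘from from∘to) (⊤-finite ⊎-finite fin)
  where
  to : Maybe A → ⊤ ⊎ A
  to nothing  = inj₁ tt
  to (just x) = inj₂ x

  from : ⊤ ⊎ A → Maybe A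
  from (inj₁ _) = nothing
  from (inj₂ x) = just x

  to∘from : ∀ x → to (from x) ≡ x
  to∘from (inj₁ _) = refl
  to∘from (inj₂ _) = refl

  from∘to : ∀ x → from (to x) ≡ x
  from∘to nothing  = refl
  from∘to (just _) = refl

Vec-finite : ∀ {A} → Finite A → ∀ n → Finite (Vec A n)
Vec-finite fin zero    =
  ↔-finite (mk↔ₛ′ (λ _ → tt) (λ _ → []) (λ _ → refl) (λ { [] → refl })) ⊤-finite
Vec-finite fin (suc n) = ↔-finite
  (mk↔ₛ′ (λ { (x ∷ xs) → x , xs }) (λ { (x , xs) → x ∷ xs }) (λ { (_ , _) → refl })
    (λ { (_ ∷ _) → refl }))
  (fin ×-finite Vec-finite fin n)

abstract
  finite-≟ : ∀ {A} → Finite A → DecidableEquality A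
  finite-≟ (_ , a) = via-injection (↔⇒↣ a) Fin._≟_

inhabited-finite : ∀ {A} → Finite A → A → ∃[ n ] A ↔ Fin (suc n)
inhabited-finite (zero  , a) x = contradiction (Inverse.to a x) Fin.¬Fin0
inhabited-finite (suc n , a) x = n , a

-- Tapes as pairs of stacks, and the locality of a machine step

nth : {A : Set} → ℕ → List (Maybe A) → Maybe A
nth _       []       = nothing
nth zero    (x ∷ _)  = x
nth (suc i) (_ ∷ xs) = nth i xs

nth-beyond : ∀ {A : Set} i (xs : List (Maybe A)) → length xs ℕ.≤ i → nth i xs ≡ nothing
nth-beyond i       []       _       = refl
nth-beyond (suc i) (x ∷ xs) (s≤s h) = nth-beyond i xs h

data Side : Set where
  behind ahead : Side

Side-finite : Finite Side
Side-finite = ↔-finite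
  (mk↔ₛ′ (λ { behind → false ; ahead → true }) (λ { false → behind ; true → ahead })
         (λ { false → refl ; true → refl }) (λ { behind → refl ; ahead → refl }))
  Bool-finite

stack : ∀ {Γ} → Side → Tape Γ → List (Maybe Γ)
stack behind = Tape.before
stack ahead  = Tape.after

data Motion : Set where
  push pop keep : Motion

-- Each side of the tape is a stack with its top next to the head. Moving away from a side pushes
-- the scanned symbol on it, moving towards it pops.
motion : Side → Shift → Motion
motion _      stay  = keep
motion behind right = push
motion behind left  = pop
motion ahead  left  = push
motion ahead  right = pop

moved : {A : Set} → Motion → ℕ → Maybe A → List (Maybe A) → Maybe A
moved push i x xs = nth i (x ∷ xs)
moved pop  i x xs = nth (suc i) xs
moved keep i x xs = nth i xs

nth-shift : ∀ {Γ : Set} s d i (t : Tape Γ) →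
            nth i (stack s (shift d t)) ≡ moved (motion s d) i (Tape.head t) (stack s t)
nth-shift behind stay  i t = refl
nth-shift ahead  stay  i t = refl
nth-shift behind left  i (tape [] x r) = refl
nth-shift behind left  i (tape (y ∷ l) x r) = refl
nth-shift behind right i (tape l x []) = refl
nth-shift behind right i (tape l x (y ∷ r)) = refl
nth-shift ahead  left  i (tape [] x r) = refl
nth-shift ahead  left  i (tape (y ∷ l) x r) = refl
nth-shift ahead  right i (tape l x []) = refl
nth-shift ahead  right i (tape l x (y ∷ r)) = refl

headAfter : ∀ {Γ : Set} → Shift → Tape Γ → Maybe Γ
headAfter stay  t = Tape.head t
headAfter left  t = nth 0 (stack behind t)
headAfter right t = nth 0 (stack ahead t)

head-shift : ∀ {Γ : Set} d (t : Tape Γ) → Tape.head (shift d t) ≡ headAfter d t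
head-shift stay  t = refl
head-shift left  (tape [] x r) = refl
head-shift left  (tape (y ∷ l) x r) = refl
head-shift right (tape l x []) = refl
head-shift right (tape l x (y ∷ r)) = refl

-- Tape cells are addressed relative to the head, so that an atom at time suc n
-- depends on the state and the scanned symbols at time n (the view) and on at
-- most one further atom at time n.
module Locality {k : ℕ} (M : TM (Fin k) ⊥) where
  open TM M

  Cell : Set
  Cell = Maybe Γ

  Kind : Set
  Kind = Side × Fin tapes × Cell

  Fixed : Set
  Fixed = Bool ⊎ (⊤ ⊎ (State ⊎ (Fin tapes × Cell)))

  -- The split separates the claims whose number depends on `M` alone from those indexed by the
  -- distance of a cell from the head.
  data Atom : Set where
    fixed : Fixed → Atom
    cell  : ℕ → Kind → Atom

  pattern known b    = fixed (inj₁ b)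
  pattern okay       = fixed (inj₂ (inj₁ tt))
  pattern inState q  = fixed (inj₂ (inj₂ (inj₁ q)))
  pattern scanned j γ = fixed (inj₂ (inj₂ (inj₂ (j , γ))))

  View : Set
  View = State × Vec Cell tapes

  abstract
    Cell-finite : Finite Cell
    Cell-finite = Maybe-finite Γ-finite

    Kind-finite : Finite Kind
    Kind-finite = Side-finite ×-finite (Fin-finite tapes ×-finite Cell-finite)

    Fixed-finite : Finite Fixed
    Fixed-finite = Bool-finite ⊎-finite
      (⊤-finite ⊎-finite (State-finite ⊎-finite (Fin-finite tapes ×-finite Cell-finite)))

    View-finite : Finite View
    View-finite = State-finite ×-finite Vec-finite Cell-finite tapes

  _≟ˢ_ : DecidableEquality State
  _≟ˢ_ = finite-≟ State-finite

  _≟ᶜ_ : DecidableEquality Cell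
  _≟ᶜ_ = finite-≟ Cell-finite

  -- A view without transition idles: each symbol is rewritten and no head moves. So a halted
  -- configuration repeats forever, and claims make sense at every time.
  response : View → State × Vec (Cell × Shift) tapes
  response (q , γs) with δ q γs
  ... | nothing            = q , Vec.map (_, stay) γs
  ... | just (q′ , as , _) = q′ , as

  rejecting : View → Bool
  rejecting (q , γs) = is-nothing (δ q γs) ∧ not (accepting q)

  -- Given the view, a claim one step later is either settled, for instance when it concerns the
  -- symbol just written, or amounts to a claim about a single cell before the step.
  data Datum : Set where
    truth : Bool → Datum
    cell  : ℕ → Kind → Datum

  datumAtom : Datum → Atom
  datumAtom (truth b)  = known b
  datumAtom (cell i c) = cell i c

  headDatum : Fin tapes → Cell → Cell × Shift → Datum
  headDatum j γ (x , stay)  = truth (does (x ≟ᶜ γ))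
  headDatum j γ (x , left)  = cell 0 (behind , j , γ)
  headDatum j γ (x , right) = cell 0 (ahead , j , γ)

  cellDatum : ℕ → Kind → Cell → Motion → Datum
  cellDatum zero    (_ , _ , γ) x push = truth (does (x ≟ᶜ γ))
  cellDatum (suc i) c           x push = cell i c
  cellDatum i       c           x pop  = cell (suc i) c
  cellDatum i       c           x keep = cell i c

  datum : Atom → View → Datum
  datum (known b)              v = truth b
  datum okay                   v = truth (not (rejecting v))
  datum (inState q)            v = truth (does (proj₁ (response v) ≟ˢ q))
  datum (scanned j γ)          v = headDatum j γ (lookup (proj₂ (response v)) j)
  datum (cell i c@(s , j , γ)) v =
    let x , d = lookup (proj₂ (response v)) j in cellDatum i c x (motion s d)

  check : View → Fin (suc tapes) → Fixed
  check (q , γs) zero    = inj₂ (inj₂ (inj₁ q))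
  check (q , γs) (suc j) = inj₂ (inj₂ (inj₂ (j , lookup γs j)))

  premise : Atom → View → Fin (suc (suc tapes)) → Atom
  premise a v zero    = datumAtom (datum a v)
  premise a v (suc κ) = fixed (check v κ)

  module _ (w : List (Fin k)) where

    history : ℕ → Config
    history zero    = initial w
    history (suc n) = step (history n)

    view : ℕ → View
    view n = state (history n) , Vec.map Tape.head (contents (history n))

    -- Inspecting the preceding configuration is enough, since a halted machine does not change: an
    -- earlier rejection is still visible there.
    notRejected : ℕ → Bool
    notRejected zero    = true
    notRejected (suc n) = not (rejecting (view n))

    Holds : ℕ → Atom → Bool
    Holds n (known b)     = b
    Holds n okay                = notRejected n
    Holds n (inState q)   = does (state (history n) ≟ˢ q)
    Holds n (scanned j γ) = does (Tape.head (lookup (contents (history n)) j) ≟ᶜ γ)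
    Holds n (cell i (s , j , γ)) = does (nth i (stack s (lookup (contents (history n)) j)) ≟ᶜ γ)

    step-response : ∀ n → let q , as = response (view n) in
      state (history (suc n)) ≡ q × contents (history (suc n))
        ≡ Vec.zipWith act as (contents (history n))
    step-response n with δ (state (history n)) (Vec.map Tape.head (contents (history n)))
    ... | just _  = refl , refl
    ... | nothing = refl , sym (idle (contents (history n)))
      where
      idle : ∀ {m} (ts : Vec (Tape Γ) m) →
        Vec.zipWith act (Vec.map (_, stay) (Vec.map Tape.head ts)) ts ≡ ts
      idle []       = refl
      idle (t ∷ ts) = cong (t ∷_) (idle ts)

    step-tape : ∀ n j →
      let x , d = lookup (proj₂ (response (view n))) j
          t     = lookup (contents (history n)) j in
      lookup (contents (history (suc n))) j ≡ shift d (record t { head = x })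
    step-tape n j = trans (cong (λ ts → lookup ts j) (proj₂ (step-response n)))
                          (Vec.lookup-zipWith act j (proj₂ (response (view n)))
                            (contents (history n)))

    Holds-step : ∀ n a → Holds (suc n) a ≡ Holds n (datumAtom (datum a (view n)))
    Holds-step n (known b)   = refl
    Holds-step n okay        = refl
    Holds-step n (inState q) = cong (λ q′ → does (q′ ≟ˢ q)) (proj₁ (step-response n))
    Holds-step n (scanned j γ) rewrite step-tape n j with lookup (proj₂ (response (view n))) j
    ... | x , stay  = refl
    ... | x , left
      rewrite head-shift left (record (lookup (contents (history n)) j) { head = x }) = refl
    ... | x , right
      rewrite head-shift right (record (lookup (contents (history n)) j) { head = x }) = refl
    Holds-step n (cell i (s , j , γ)) rewrite step-tape n j
      with lookup (proj₂ (response (view n))) j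
    ... | x , d rewrite nth-shift s d i (record (lookup (contents (history n)) j) { head = x }) =
      cell-moved s (motion s d) i
      where
      cell-moved : ∀ s m i →
        does (moved m i x (stack s (record (lookup (contents (history n)) j) { head = x })) ≟ᶜ γ) ≡
                   Holds n (datumAtom (cellDatum i (s , j , γ) x m))
      cell-moved behind push zero    = refl
      cell-moved behind push (suc i) = refl
      cell-moved behind pop  zero    = refl
      cell-moved behind pop  (suc i) = refl
      cell-moved behind keep zero    = refl
      cell-moved behind keep (suc i) = refl
      cell-moved ahead  push zero    = refl
      cell-moved ahead  push (suc i) = refl
      cell-moved ahead  pop  zero    = refl
      cell-moved ahead  pop  (suc i) = refl
      cell-moved ahead  keep zero    = refl
      cell-moved ahead  keep (suc i) = refl

    checks⇒view : ∀ n v → (∀ κ → Holds n (fixed (check v κ)) ≡ true) → v ≡ view n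
    checks⇒view n (q , γs) h = cong₂ _,_
      (sym (does-true (state (history n) ≟ˢ q) (h zero)))
      (lookup-ext λ j → trans (sym (does-true (_ ≟ᶜ lookup γs j) (h (suc j))))
                              (sym (Vec.lookup-map j Tape.head (contents (history n)))))
      where
      does-true : ∀ {P : Set} (d : Dec P) → does d ≡ true → P
      does-true (yes p) _ = p

      lookup-ext : ∀ {A : Set} {m} {xs ys : Vec A m} → (∀ j → lookup xs j ≡ lookup ys j) → xs ≡ ys
      lookup-ext {xs = []}     {[]}     h = refl
      lookup-ext {xs = x ∷ xs} {y ∷ ys} h = cong₂ _∷_ (h zero) (lookup-ext (h ∘ suc))

    view-checks : ∀ n κ → Holds n (fixed (check (view n) κ)) ≡ true
    view-checks n zero    = dec-true (state (history n) ≟ˢ _) refl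
    view-checks n (suc j) =
      dec-true (_ ≟ᶜ _) (sym (Vec.lookup-map j Tape.head (contents (history n))))

    Holds-win : ∀ n a → Holds (suc n) a ≡ true → ∃[ v ] ∀ κ → Holds n (premise a v κ) ≡ true
    Holds-win n a h = view n , λ
      { zero    → trans (sym (Holds-step n a)) h
      ; (suc κ) → view-checks n κ
      }

    -- If all checks hold, the named view is the actual one and the datum inherits the falsity of
    -- the claim. Otherwise a failing check is the false premise.
    Holds-lose : ∀ n a → Holds (suc n) a ≡ false → ∀ v → ∃[ κ ] Holds n (premise a v κ) ≡ false
    Holds-lose n a h v with Fin.all? (λ κ → Holds n (fixed (check v κ)) Bool.≟ true)
    ... | yes all rewrite checks⇒view n v all = zero , trans (sym (Holds-step n a)) h
    ... | no ¬all = let κ , ¬h = ¬∀⟶∃¬ _ _ (λ κ → Holds n (fixed (check v κ)) Bool.≟ true) ¬all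
                    in suc κ , ¬-not ¬h

    run-suc : ∀ t c → run (suc t) c ≡ step (run t c)
    run-suc zero    c = refl
    run-suc (suc t) c = run-suc t (step c)

    history-run : ∀ n → history n ≡ run n (initial w)
    history-run zero    = refl
    history-run (suc n) = trans (cong step (history-run n)) (sym (run-suc n (initial w)))

    step-halted : ∀ c → Halted c → step c ≡ c
    step-halted c h with transition c
    ... | nothing = refl

    history-halted : ∀ n → Halted (history n) → ∀ e → history (e ℕ.+ n) ≡ history n
    history-halted n h zero    = refl
    history-halted n h (suc e) =
      trans (cong step (history-halted n h e)) (step-halted (history n) h)

    halted-unique : ∀ m n → Halted (history m) → Halted (history n) → history m ≡ history n
    halted-unique m n hm hn = begin
      history m           ≡⟨ history-halted m hm n ⟨
      history (n ℕ.+ m)   ≡⟨ cong history (ℕ.+-comm n m) ⟩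
      history (m ℕ.+ n)   ≡⟨ history-halted n hn m ⟩
      history n           ∎
      where open ≡-Reasoning

    module _ {bound} {L : Language (Fin k)} (dec : DecidesInSpace bound L) where

      -- Any two halting configurations of the run coincide, so the verdict at the given halting
      -- time is the one seen at every halting time.
      accepts⇔okay : L w ⇔ (∀ n → Holds n okay ≡ true)
      accepts⇔okay = mk⇔ to from
        where
        t   = proj₁ (proj₂ (dec w))
        hlt : Halted (history t)
        hlt = subst Halted (sym (history-run t)) (proj₁ (proj₂ (proj₂ (dec w))))
        acc : L w ⇔ accepting (state (history t)) ≡ true
        acc = subst (λ c → L w ⇔ accepting (state c) ≡ true) (sym (history-run t))
          (proj₂ (proj₂ (proj₂ (dec w))))

        to : L w → ∀ n → Holds n okay ≡ true
        to l zero    = refl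
        to l (suc n) with transition (history n) in eq
        ... | just _  = refl
        ... | nothing rewrite halted-unique n t eq hlt | Equivalence.to acc l = refl

        from : (∀ n → Holds n okay ≡ true) → L w
        -- The time is `suc t` because the claim at `suc t` speaks about the configuration at `t`.
        from all = Equivalence.from acc (accepted (all (suc t)))
          where
          accepted : not (rejecting (view t)) ≡ true → accepting (state (history t)) ≡ true
          accepted h rewrite hlt with accepting (state (history t))
          ... | true = refl

      -- Each stack is part of the recorded cells of its tape, which the space bound limits at every
      -- time; a cell beyond the bound lies below the bottom of the stack and reads as blank.
      cell-beyond : ∀ n i s j γ → bound (length w) ℕ.≤ i →
        Holds n (cell i (s , j , γ)) ≡ does (nothing ≟ᶜ γ)
      cell-beyond n i s j γ h = 
        cong (λ x → does (x ≟ᶜ γ))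
          (nth-beyond i (stack s (lookup (contents (history n)) j)) (ℕ.≤-trans (short s) h))
        where
        cells-sum : ∀ {m} (ts : Vec (Tape Γ) m) j →
          cells (lookup ts j) ℕ.≤ Vec.sum (Vec.map cells ts)
        cells-sum (t ∷ ts) zero    = ℕ.m≤m+n _ _
        cells-sum (t ∷ ts) (suc j) = ℕ.≤-trans (cells-sum ts j) (ℕ.m≤n+m _ _)

        cells≤ : cells (lookup (contents (history n)) j) ℕ.≤ bound (length w)
        cells≤ = ℕ.≤-trans (cells-sum (contents (history n)) j)
          (subst (λ c → space c ℕ.≤ bound (length w)) (sym (history-run n)) (proj₁ (dec w) n))

        short : ∀ s → length (stack s (lookup (contents (history n)) j)) ℕ.≤ bound (length w)
        short behind = ℕ.≤-trans (ℕ.m≤m+n _ _) cells≤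
        short ahead  = ℕ.≤-trans (ℕ.≤-trans (ℕ.n≤1+n _) (ℕ.m≤n+m _ _)) cells≤

-- Concatenated blocks, layers and templates

module _ {X : Set} where
  concat-tabulate-cong : ∀ {n} {f g : Fin n → List X} → (∀ i → f i ≡ g i) →
    concat (tabulate f) ≡ concat (tabulate g)
  concat-tabulate-cong h = cong concat (List.tabulate-cong h)

  concat-tabulate-+ : ∀ m {n} (f : Fin (m ℕ.+ n) → List X) →
    concat (tabulate f) ≡ concat (tabulate (f ∘ (_↑ˡ n))) ++ concat (tabulate (f ∘ (m ↑ʳ_)))
  concat-tabulate-+ zero    f = refl
  concat-tabulate-+ (suc m) f =
    trans (cong (f zero ++_) (concat-tabulate-+ m (f ∘ suc))) (sym (List.++-assoc (f zero) _ _))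

  concat-tabulate-* : ∀ m {n} (f : Fin (m ℕ.* n) → List X) →
    concat (tabulate f) ≡ concat (tabulate {n = m} λ i → concat (tabulate λ j → f (combine i j)))
  concat-tabulate-* zero        f = refl
  concat-tabulate-* (suc m) {n} f = trans (concat-tabulate-+ n f)
    (cong (concat (tabulate (f ∘ (_↑ˡ (m ℕ.* n)))) ++_) (concat-tabulate-* m (f ∘ (n ↑ʳ_))))

  concat-tabulate-last : ∀ m (f : Fin (suc m) → List X) →
    concat (tabulate f) ≡ concat (tabulate (f ∘ inject₁)) ++ f (fromℕ m)
  concat-tabulate-last zero    f = List.++-identityʳ (f zero)
  concat-tabulate-last (suc m) f =
    trans (cong (f zero ++_) (concat-tabulate-last m (f ∘ suc))) (sym (List.++-assoc (f zero) _ _))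

firstSymbol : {A : Set} → List A → Maybe A
firstSymbol []      = nothing
firstSymbol (x ∷ _) = just x

others : {A : Set} → List A → List A
others []       = []
others (_ ∷ xs) = xs

symbolAt : {A : Set} → ℕ → List A → Maybe A
symbolAt zero    xs = firstSymbol xs
symbolAt (suc i) xs = symbolAt i (others xs)

symbolAt-[] : {A : Set} → ∀ i → symbolAt {A} i [] ≡ nothing
symbolAt-[] zero    = refl
symbolAt-[] (suc i) = symbolAt-[] i

-- The output of a loop of n rounds that counts upwards from i while the input
-- head advances over the remaining input r.
layers : {A X : Set} → (ℕ → Maybe A → List X) → ℕ → ℕ → List A → List X
layers f zero    i r = []
layers f (suc n) i r = f i (firstSymbol r) ++ layers f n (suc i) (others r)

layers-tabulate : ∀ {A X : Set} (f : ℕ → Maybe A → List X) n i r →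
  concat (tabulate {n = n} λ j → f (i ℕ.+ toℕ j) (symbolAt (toℕ j) r)) ≡ layers f n i r
layers-tabulate f zero    i r = refl
layers-tabulate f (suc n) i r = cong₂ _++_
  (cong (λ j → f j (firstSymbol r)) (ℕ.+-identityʳ i))
  (trans (concat-tabulate-cong {n = n} λ j →
    cong (λ e → f e (symbolAt (toℕ j) (others r))) (ℕ.+-suc i (toℕ j)))
         (layers-tabulate f n (suc i) (others r)))

-- A template is instantiated by a layer index and the input symbol scanned
-- while that layer is printed.
data Piece (A : Set) : Set where
  lit : Symbol → Piece A
  rep : List Symbol → Piece A
  inp : (Maybe A → Symbol) → Piece A

module _ {A : Set} where

  evalPiece : ℕ → Maybe A → Piece A → List Symbol
  evalPiece i x (lit s) = [ s ]
  evalPiece i x (rep s) = concat (replicate i s)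
  evalPiece i x (inp f) = [ f x ]

  render : ℕ → Maybe A → List (Piece A) → List Symbol
  render i x = concatMap (evalPiece i x)

  text : List Symbol → List (Piece A)
  text = List.map lit

  -- (a , b) stands for the number a + i * b.
  tallies : ℕ × ℕ → List (Piece A)
  tallies (a , b) = text (replicate a tally) ++ [ rep (replicate b tally) ]

  location : Symbol → ℕ × ℕ → List (Piece A)
  location s n = lit s ∷ tallies n ++ [ lit sep ]

  transitions : ∀ {n} → (Fin n → List (Piece A)) → List (Piece A)
  transitions f = concat (tabulate f) ++ [ lit end ]

  module _ (i : ℕ) (x : Maybe A) where

    render-++ : ∀ ps qs → render i x (ps ++ qs) ≡ render i x ps ++ render i x qs
    render-++ = List.concatMap-++ (evalPiece i x)

    render-text : ∀ s → render i x (text s) ≡ s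
    render-text []      = refl
    render-text (c ∷ s) = cong (c ∷_) (render-text s)

    render-concat : ∀ {n} (f : Fin n → List (Piece A)) →
                    render i x (concat (tabulate f)) ≡ concat (tabulate (render i x ∘ f))
    render-concat {zero}  f = refl
    render-concat {suc n} f =
      trans (render-++ (f zero) _) (cong (render i x (f zero) ++_) (render-concat (f ∘ suc)))

    replicate-+ : ∀ m n → replicate m tally ++ replicate n tally ≡ replicate (m ℕ.+ n) tally
    replicate-+ zero    n = refl
    replicate-+ (suc m) n = cong (tally ∷_) (replicate-+ m n)

    replicate-* : ∀ i b → concat (replicate i (replicate b tally)) ≡ replicate (i ℕ.* b) tally
    replicate-* zero    b = refl
    replicate-* (suc i) b =
      trans (cong (replicate b tally ++_) (replicate-* i b)) (replicate-+ b (i ℕ.* b))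

    render-tallies : ∀ a b → render i x (tallies (a , b)) ≡ replicate (a ℕ.+ i ℕ.* b) tally
    render-tallies a b = begin
      render i x (tallies (a , b))
        ≡⟨ render-++ (text (replicate a tally)) _ ⟩
      render i x (text (replicate a tally)) ++ (concat (replicate i (replicate b tally)) ++ [])
        ≡⟨ cong₂ _++_ (render-text (replicate a tally))
          (trans (List.++-identityʳ _) (replicate-* i b)) ⟩
      replicate a tally ++ replicate (i ℕ.* b) tally
        ≡⟨ replicate-+ a (i ℕ.* b) ⟩
      replicate (a ℕ.+ i ℕ.* b) tally ∎
      where open ≡-Reasoning

    render-location : ∀ s a b {n} → n ≡ a ℕ.+ i ℕ.* b →
                      s ∷ replicate n tally ∷ʳ sep ≡ render i x (location s (a , b))
    render-location s a b refl = cong (s ∷_) (sym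
      (trans (render-++ (tallies (a , b)) _) (cong (_++ [ sep ]) (render-tallies a b))))

    render-transitions : ∀ {n} {g : Fin n → List Symbol} f → (∀ j → g j ≡ render i x (f j)) →
                         concat (tabulate g) ∷ʳ end ≡ render i x (transitions f)
    render-transitions f h = sym (trans (render-++ (concat (tabulate f)) _)
      (cong (_++ [ end ]) (trans (render-concat f) (concat-tabulate-cong λ j → sym (h j)))))

-- The automaton of a machine and the text of its OC-MDP

module Reduction {k : ℕ} (M : TM (Fin k) ⊥) where
  open TM M
  open Locality M

  -- These numbers depend on `M` only, so templates built from them are constants of the printing
  -- program; the input affects just the number of layers and the initial truth values.
  G C V : ℕ
  G = proj₁ Fixed-finite
  C = proj₁ Kind-finite

  views : ∃[ n ] View ↔ Fin (suc n)
  views = inhabited-finite View-finite (start , Vec.replicate tapes nothing)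

  V = proj₁ views

  fixedIndex : Fixed → Fin G
  fixedIndex = Inverse.to (proj₂ Fixed-finite)

  kindIndex : Kind → Fin C
  kindIndex = Inverse.to (proj₂ Kind-finite)

  fixedAt : Fin G → Fixed
  fixedAt = Inverse.from (proj₂ Fixed-finite)

  kindAt : Fin C → Kind
  kindAt = Inverse.from (proj₂ Kind-finite)

  viewAt : Fin (suc V) → View
  viewAt = Inverse.from (proj₂ views)

  fixedAt-index : ∀ f → fixedAt (fixedIndex f) ≡ f
  fixedAt-index = Inverse.strictlyInverseʳ (proj₂ Fixed-finite)

  kindAt-index : ∀ c → kindAt (kindIndex c) ≡ c
  kindAt-index = Inverse.strictlyInverseʳ (proj₂ Kind-finite)

  blank : Kind → Atom
  blank (_ , _ , γ) = known (does (nothing ≟ᶜ γ))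

  -- Fixed claims are numbered first, then the cells layer by layer. Moving a cell one place further
  -- from the head thus adds `C`, the slope recorded by `stride`.
  offset : Atom → ℕ
  offset (fixed f)  = toℕ (fixedIndex f)
  offset (cell i c) = G ℕ.+ (C ℕ.* i ℕ.+ toℕ (kindIndex c))

  stride : Atom → ℕ
  stride (fixed _)  = 0
  stride (cell _ _) = C

  raise : ℕ → Atom → Atom
  raise i (fixed f)  = fixed f
  raise i (cell d c) = cell (d ℕ.+ i) c

  offset-raise : ∀ i a → offset (raise i a) ≡ offset a ℕ.+ i ℕ.* stride a
  offset-raise i (fixed f)  =
    sym (trans (cong (toℕ (fixedIndex f) ℕ.+_) (ℕ.*-zeroʳ i)) (ℕ.+-identityʳ _))
  offset-raise i (cell d c) =
    solve 5 (λ g c i d κ → g :+ (c :* (d :+ i) :+ κ) := (g :+ (c :* d :+ κ)) :+ i :* c)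
    refl G C i d (toℕ (kindIndex c))
    where open ℕ-Solver

  -- For the top layer, whose cells are `raise m (cell 1 c)`. A premise of `cell 1 c` at distance 2
  -- then leaves the numbered range and is replaced by its constant truth value.
  clip : Atom → Atom
  clip (cell (suc (suc _)) c) = blank c
  clip a                      = a

  -- At distance 0 a push exposes the written symbol instead of a cell. From distance 1 on, the
  -- premises move along with the cell, so the premises of `cell 1 c` describe all these layers.
  premise-raise : ∀ i c v κ → premise (cell (suc i) c) v κ ≡ raise i (premise (cell 1 c) v κ)
  premise-raise i c           v (suc κ) = refl
  premise-raise i (s , j , γ) v zero with lookup (proj₂ (response v)) j
  ... | x , d with motion s d
  ...   | push = refl
  ...   | pop  = refl
  ...   | keep = refl

  Below : ℕ → Atom → Set
  Below n (fixed _)  = ⊤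
  Below n (cell i _) = i ℕ.< n

  premise-fixed-below : ∀ f v κ → Below 1 (premise (fixed f) v κ)
  premise-fixed-below f                         v (suc κ) = tt
  premise-fixed-below (inj₁ _)                  v zero = tt
  premise-fixed-below (inj₂ (inj₁ _))           v zero = tt
  premise-fixed-below (inj₂ (inj₂ (inj₁ _)))    v zero = tt
  premise-fixed-below (inj₂ (inj₂ (inj₂ (j , γ)))) v zero with lookup (proj₂ (response v)) j
  ... | x , stay  = tt
  ... | x , left  = s≤s z≤n
  ... | x , right = s≤s z≤n

  premise-cell-below : ∀ i c v κ → Below (2 ℕ.+ i) (premise (cell i c) v κ)
  premise-cell-below i c           v (suc κ) = tt
  premise-cell-below i (s , j , γ) v zero with lookup (proj₂ (response v)) j
  ... | x , d with motion s d
  premise-cell-below zero    _ v zero | x , d | push = tt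
  premise-cell-below (suc i) _ v zero | x , d | push = ℕ.m≤n+m (suc i) 2
  premise-cell-below zero    _ v zero | x , d | pop  = ℕ.≤-refl
  premise-cell-below (suc i) _ v zero | x , d | pop  = ℕ.≤-refl
  premise-cell-below zero    _ v zero | x , d | keep = s≤s z≤n
  premise-cell-below (suc i) _ v zero | x , d | keep = ℕ.m≤n+m (suc (suc i)) 1

  initialCell : Fin tapes → Maybe (Fin k) → Cell
  initialCell zero    x = Maybe.map inputSymbol x
  initialCell (suc _) x = nothing

  -- The initial truth value of an atom, as a function of the only input symbol
  -- it depends on.
  initially : Atom → Maybe (Fin k) → Bool
  initially (known b)               x = b
  initially okay                    x = true
  initially (inState q)             x = does (start ≟ˢ q)
  initially (scanned j γ)           x = does (initialCell j x ≟ᶜ γ)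
  initially (cell _ (behind , j , γ)) x = does (nothing ≟ᶜ γ)
  initially (cell _ (ahead , j , γ))  x = does (initialCell j x ≟ᶜ γ)

  head-wordTape : ∀ w → Tape.head (wordTape (List.map inputSymbol w))
    ≡ Maybe.map inputSymbol (firstSymbol w)
  head-wordTape []      = refl
  head-wordTape (x ∷ w) = refl

  nth-after-wordTape : ∀ i w → nth i (Tape.after (wordTape (List.map inputSymbol w)))
    ≡ Maybe.map inputSymbol (symbolAt (suc i) w)
  nth-after-wordTape i (x ∷ w) = go i w
    where
    go : ∀ i w → nth i (List.map just (List.map inputSymbol w))
      ≡ Maybe.map inputSymbol (symbolAt i w)
    go zero    []      = refl
    go (suc i) []      = go i []
    go zero    (x ∷ w) = refl
    go (suc i) (x ∷ w) = go i w
  nth-after-wordTape i [] = sym (cong (Maybe.map inputSymbol) (symbolAt-[] i))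

  Holds-initially-fixed : ∀ w f → Holds w 0 (fixed f) ≡ initially (fixed f) (firstSymbol w)
  Holds-initially-fixed w (inj₁ _)               = refl
  Holds-initially-fixed w (inj₂ (inj₁ _))        = refl
  Holds-initially-fixed w (inj₂ (inj₂ (inj₁ _))) = refl
  Holds-initially-fixed w (inj₂ (inj₂ (inj₂ (zero  , γ)))) =
    cong (λ y → does (y ≟ᶜ γ)) (head-wordTape w)
  Holds-initially-fixed w (inj₂ (inj₂ (inj₂ (suc j , γ)))) =
    cong (λ t → does (Tape.head t ≟ᶜ γ)) (Vec.lookup-replicate j emptyTape)

  Holds-initially-cell : ∀ w i d c →
    Holds w 0 (cell i c) ≡ initially (cell d c) (symbolAt (suc i) w)
  Holds-initially-cell []      i d (behind , zero , γ) = refl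
  Holds-initially-cell (_ ∷ _) i d (behind , zero , γ) = refl
  Holds-initially-cell w i d (behind , suc j , γ) =
    cong (λ t → does (nth i (Tape.before t) ≟ᶜ γ)) (Vec.lookup-replicate j emptyTape)
  Holds-initially-cell w i d (ahead , zero  , γ) =
    cong (λ y → does (y ≟ᶜ γ)) (nth-after-wordTape i w)
  Holds-initially-cell w i d (ahead , suc j , γ) =
    cong (λ t → does (nth i (Tape.after t) ≟ᶜ γ)) (Vec.lookup-replicate j emptyTape)

  Template : Set
  Template = List (Piece (Fin k))

  move : Step₊ → Symbol → ℕ × ℕ → List Symbol → Template
  move s l n label = lit (sign s) ∷ location l n ++ text label

  render-move : ∀ i x s l a b label {n} → n ≡ a ℕ.+ i ℕ.* b →
    sign s ∷ (l ∷ replicate n tally ∷ʳ sep) ++ label ≡ render i x (move s l (a , b) label)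
  render-move i x s l a b label eq =
    cong (sign s ∷_) (sym (trans (render-++ i x (location l (a , b)) (text label))
    (cong₂ _++_ (sym (render-location i x l a b eq)) (render-text i x label))))

  sinkMove : List Symbol → Fin 1 → Template
  sinkMove label _ = move stay nondet (offset (known false) , 0) label

  -- The target is `suc (combine α v)`: passing to it multiplies both the offset and the slope of
  -- the atom by the number of choices.
  choiceMove : Atom → Fin (suc V) → Template
  choiceMove a v = move stay probab (suc (suc V ℕ.* offset a ℕ.+ toℕ v) , suc V ℕ.* stride a) []

  demandMove : (Fin (suc (suc tapes)) → Atom) → Fin (suc (suc tapes)) → Template
  demandMove a κ = move down nondet (offset (a κ) , stride (a κ)) (encodeℚ (share (suc tapes)))

  startMove : Fin 2 → Template
  startMove 0F = move up probab (0 , 0) (encodeℚ (share 1))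
  startMove 1F = move stay nondet (offset okay , 0) (encodeℚ (share 1))

  nondetBlock : Atom → Template
  nondetBlock a = inp (λ x → bit (if initially a x then 1F else 0F)) ∷
    transitions (sinkMove []) ++ transitions (choiceMove a)

  probBlock : (Fin (suc (suc tapes)) → Atom) → Template
  probBlock a =
    lit (bit 0F) ∷ transitions (sinkMove (encodeℚ (share 0))) ++ transitions (demandMove a)

  startBlock : Template
  startBlock = lit (bit 0F) ∷ transitions startMove ++ transitions startMove

  probBlocks : (View → Fin (suc (suc tapes)) → Atom) → Template
  probBlocks a = concat (tabulate λ v → probBlock (a (viewAt v)))

  overFixed : (Fixed → Template) → Template
  overFixed t = concat (tabulate λ g → t (fixedAt g))

  overKinds : (Kind → Template) → Template
  overKinds t = concat (tabulate λ c → t (kindAt c))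

  -- Layers after the bottom one are rendered relative to `cell 1`, so index `i` stands for distance
  -- `i + 1`. The bottom layer is apart because `premise-raise` starts at distance 1, and `probTop`
  -- because its premises are clipped.
  nondetFixed probFixed probBottom probMiddle probTop : Template
  nondetLayer : ℕ → Template
  nondetFixed   = overFixed λ f → nondetBlock (fixed f)
  nondetLayer d = overKinds λ c → nondetBlock (cell d c)
  probFixed     = overFixed λ f → probBlocks (premise (fixed f))
  probBottom    = overKinds λ c → probBlocks (premise (cell 0 c))
  probMiddle    = overKinds λ c → probBlocks (premise (cell 1 c))
  probTop       = overKinds λ c → probBlocks (λ v κ → clip (premise (cell 1 c) v κ))

  module Bounded (m : ℕ) where

    -- One bottom layer, `m` middle layers and one top layer.
    L : ℕ
    L = suc (suc m)

    cellAt : Fin L × Fin C → Atom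
    cellAt (i , c) = cell (toℕ i) (kindAt c)

    decode : Fin (G ℕ.+ L ℕ.* C) → Atom
    decode α = [ fixed ∘ fixedAt , cellAt ∘ remQuot {L} C ]′ (splitAt G α)

    fromFixed : Fixed → Fin (G ℕ.+ L ℕ.* C)
    fromFixed f = fixedIndex f ↑ˡ (L ℕ.* C)

    fromCell : Fin L → Kind → Fin (G ℕ.+ L ℕ.* C)
    fromCell i c = G ↑ʳ combine {L} {C} i (kindIndex c)

    blankFixed : Kind → Fixed
    blankFixed (_ , _ , γ) = inj₁ (does (nothing ≟ᶜ γ))

    -- A cell out of range becomes the constant claim that its symbol is blank or not, which has the
    -- same truth value once the range covers the space bound.
    encode : Atom → Fin (G ℕ.+ L ℕ.* C)
    encode (fixed f)  = fromFixed f
    encode (cell i c) with i ℕ.<? L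
    ... | yes i<L = fromCell (fromℕ< i<L) c
    ... | no  _   = fromFixed (blankFixed c)

    decode-fixed : ∀ f → decode (fromFixed f) ≡ fixed f
    decode-fixed f rewrite splitAt-↑ˡ G (fixedIndex f) (L ℕ.* C) = cong fixed (fixedAt-index f)

    decode-cell : ∀ i c → decode (fromCell i c) ≡ cell (toℕ i) c
    decode-cell i c = begin
      decode (fromCell i c)
        ≡⟨ cong [ fixed ∘ fixedAt , cellAt ∘ remQuot {L} C ]′
          (splitAt-↑ʳ G (L ℕ.* C) (combine {L} {C} i (kindIndex c))) ⟩
      cellAt (remQuot {L} C (combine {L} {C} i (kindIndex c)))
        ≡⟨ cong cellAt (remQuot-combine {L} {C} i (kindIndex c)) ⟩
      cell (toℕ i) (kindAt (kindIndex c))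
        ≡⟨ cong (cell (toℕ i)) (kindAt-index c) ⟩
      cell (toℕ i) c ∎
      where open ≡-Reasoning

    decode-encode : ∀ a →
      decode (encode a) ≡ a ⊎
      (∃[ i ] ∃[ c ] a ≡ cell i c × L ℕ.≤ i × decode (encode a) ≡ fixed (blankFixed c))
    decode-encode (fixed f)  = inj₁ (decode-fixed f)
    decode-encode (cell i c) with i ℕ.<? L
    ... | yes i<L = inj₁
      (trans (decode-cell (fromℕ< i<L) c) (cong (λ i → cell i c) (toℕ-fromℕ< i<L)))
    ... | no  i≮L = inj₂ (i , c , refl , ℕ.≮⇒≥ i≮L , decode-fixed (blankFixed c))

    toℕ-fromFixed : ∀ f → toℕ (fromFixed f) ≡ offset (fixed f)
    toℕ-fromFixed f = toℕ-↑ˡ (fixedIndex f) (L ℕ.* C)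

    toℕ-fromCell : ∀ i c → toℕ (fromCell i c) ≡ offset (cell (toℕ i) c)
    toℕ-fromCell i c = trans (toℕ-↑ʳ G (combine {L} {C} i (kindIndex c)))
      (cong (G ℕ.+_) (toℕ-combine i (kindIndex c)))

    toℕ-encode-cell : ∀ i c → i ℕ.< L → toℕ (encode (cell i c)) ≡ offset (cell i c)
    toℕ-encode-cell i c i<L with i ℕ.<? L
    ... | yes p = trans (toℕ-fromCell (fromℕ< p) c) (cong (λ i → offset (cell i c)) (toℕ-fromℕ< p))
    ... | no ¬p = contradiction i<L ¬p

    toℕ-encode-blank : ∀ i c → L ℕ.≤ i → toℕ (encode (cell i c)) ≡ offset (blank c)
    toℕ-encode-blank i c L≤i with i ℕ.<? L
    ... | yes p = contradiction p (ℕ.≤⇒≯ L≤i)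
    ... | no ¬p = toℕ-fromFixed (blankFixed c)

    -- Decoding tells the premises apart. A datum decodes to a constant or a cell, even when it was
    -- out of range, whereas the checks concern the state and the symbols scanned on different
    -- tapes.
    encode-premise-injective : ∀ a v → Injective _≡_ _≡_ (λ κ → encode (premise a v κ))
    encode-premise-injective a v eq = injective _ _ (cong decode eq)
      where
      datum-not-check : ∀ d κ → decode (encode (datumAtom d)) ≢ decode (fromFixed (check v κ))
      datum-not-check d zero eq with trans eq (decode-fixed (check v zero))
      datum-not-check (truth b) zero eq | eq′ with () ← trans (sym (decode-fixed (inj₁ b))) eq′
      datum-not-check (cell i c) zero eq | eq′ with decode-encode (cell i c)
      ... | inj₁ e with () ← trans (sym e) eq′
      ... | inj₂ (_ , _ , _ , _ , e) with () ← trans (sym e) eq′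
      datum-not-check d (suc j) eq with trans eq (decode-fixed (check v (suc j)))
      datum-not-check (truth b) (suc j) eq | eq′ with () ← trans (sym (decode-fixed (inj₁ b))) eq′
      datum-not-check (cell i c) (suc j) eq | eq′ with decode-encode (cell i c)
      ... | inj₁ e with () ← trans (sym e) eq′
      ... | inj₂ (_ , _ , _ , _ , e) with () ← trans (sym e) eq′

      check-injective : ∀ κ κ′ → fixed (check v κ) ≡ fixed (check v κ′) → κ ≡ κ′
      check-injective zero    zero    _ = refl
      check-injective (suc j) (suc _) refl = refl

      injective : ∀ κ κ′ → decode (encode (premise a v κ)) ≡ decode (encode (premise a v κ′)) →
        κ ≡ κ′
      injective zero    zero     _  = refl
      injective zero    (suc κ′) eq = contradiction eq (datum-not-check (datum a v) κ′)
      injective (suc κ) zero     eq = contradiction (sym eq) (datum-not-check (datum a v) κ)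
      injective (suc κ) (suc κ′) eq = cong suc (check-injective κ κ′
        (trans (sym (decode-fixed (check v κ))) (trans eq (decode-fixed (check v κ′)))))

    module _ (w : List (Fin k)) where

      automaton : Automaton
      automaton = record
        { A = G ℕ.+ L ℕ.* C
        ; V = V
        -- There are `suc K` demands: the datum, the state and one scanned symbol per tape.
        ; K = suc tapes
        ; pred = λ α v κ → encode (premise (decode α) (viewAt v) κ)
        ; pred-injective = λ α v → encode-premise-injective (decode α) (viewAt v)
        ; base = λ α → Holds w 0 (decode α)
        ; sink = fromFixed (inj₁ false)
        ; ok   = fromFixed (inj₂ (inj₁ tt))
        }

      module _ {bound} {Lang : Language (Fin k)} (dec : DecidesInSpace bound Lang)
        (bound≤L : bound (length w) ℕ.≤ L) where

        Holds-encode : ∀ n a → Holds w n (decode (encode a)) ≡ Holds w n a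
        Holds-encode n a with decode-encode a
        ... | inj₁ e = cong (Holds w n) e
        ... | inj₂ (i , (s , j , γ) , refl , L≤i , e) =
          trans (cong (Holds w n) e)
            (sym (cell-beyond w {bound} {Lang} dec n i s j γ (ℕ.≤-trans bound≤L L≤i)))

        open Game automaton using (gameInstance; always⇒ValOne; ValOne⇒always)

        private
          H : ℕ → Fin (G ℕ.+ L ℕ.* C) → Bool
          H n α = Holds w n (decode α)

          win : ∀ n α → H (suc n) α ≡ true → ∃[ v ] ∀ κ →
            H n (encode (premise (decode α) (viewAt v) κ)) ≡ true
          win n α h =
            let v , hv = Holds-win w n (decode α) h
                v′     = Inverse.to (proj₂ views) v
            in v′ , λ κ → trans (Holds-encode n (premise (decode α) (viewAt v′) κ))
              (trans (cong (λ v → Holds w n (premise (decode α) v κ))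
                           (Inverse.strictlyInverseʳ (proj₂ views) v))
                     (hv κ))

          lose : ∀ n α → H (suc n) α ≡ false → ∀ v →
            ∃[ κ ] H n (encode (premise (decode α) (viewAt v) κ)) ≡ false
          lose n α h v =
            let κ , hκ = Holds-lose w n (decode α) h (viewAt v)
            in κ , trans (Holds-encode n (premise (decode α) (viewAt v) κ)) hκ

          sink-false : H 0 (fromFixed (inj₁ false)) ≡ false
          sink-false = cong (Holds w 0) (decode-fixed (inj₁ false))

          ok-okay : ∀ n → H n (fromFixed (inj₂ (inj₁ tt))) ≡ Holds w n okay
          ok-okay n = cong (Holds w n) (decode-fixed (inj₂ (inj₁ tt)))

        accepted⇔ValOne : Lang w ⇔ DecisionProblem.Yes ValOneProblem gameInstance
        accepted⇔ValOne = mk⇔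
          (λ l → always⇒ValOne H (λ _ → refl) sink-false win lose
             λ n → trans (ok-okay n) (Equivalence.to (accepts⇔okay w {bound} {Lang} dec) l n))
          (λ val → Equivalence.from (accepts⇔okay w {bound} {Lang} dec) λ n →
            trans (sym (ok-okay n))
             (ValOne⇒always H (λ _ → refl) sink-false win lose val n))

    toℕ-encode : ∀ n a → Below n a → n ℕ.≤ L → toℕ (encode a) ≡ offset a
    toℕ-encode n (fixed f)  _   _   = toℕ-fromFixed f
    toℕ-encode n (cell i c) i<n n≤L = toℕ-encode-cell i c (ℕ.≤-trans i<n n≤L)

    Below-raise : ∀ n i a → Below n a → Below (n ℕ.+ i) (raise i a)
    Below-raise n i (fixed _)  _   = tt
    Below-raise n i (cell d _) d<n = ℕ.+-monoˡ-< i d<n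

    toℕ-encode-top : ∀ a → toℕ (encode (raise m a)) ≡ offset (clip a) ℕ.+ m ℕ.* stride (clip a)
    toℕ-encode-top (fixed f) = trans (toℕ-fromFixed f) (offset-raise m (fixed f))
    toℕ-encode-top (cell zero c) =
      trans (toℕ-encode-cell m c (ℕ.m≤n+m (suc m) 1)) (offset-raise m (cell 0 c))
    toℕ-encode-top (cell (suc zero) c) =
      trans (toℕ-encode-cell (suc m) c ℕ.≤-refl) (offset-raise m (cell 1 c))
    toℕ-encode-top (cell (suc (suc d)) c) =
      trans (toℕ-encode-blank (suc (suc d) ℕ.+ m) c (s≤s (s≤s (ℕ.m≤n+m m d))))
        (offset-raise m (blank c))

    -- Stated for an arbitrary family of blocks, as it serves twice: for the nondeterministic
    -- blocks, with the input read along, and for the probabilistic ones, grouped by atom and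
    -- without input.
    module _ (block : Fin (G ℕ.+ L ℕ.* C) → List Symbol) (x₀ x₁ : Maybe (Fin k)) (r : List (Fin k))
             (tF : Fixed → Template) (tB tM tT : Kind → Template)
             (hF : ∀ f → block (fromFixed f) ≡ render 0 x₀ (tF f))
             (hB : ∀ c → block (fromCell zero c) ≡ render 0 x₁ (tB c))
             (hM : ∀ i c → block (fromCell (suc (inject₁ i)) c)
               ≡ render (toℕ i) (symbolAt (toℕ i) r) (tM c))
             (hT : ∀ c → block (fromCell (suc (fromℕ m)) c) ≡ render m (symbolAt m r) (tT c))
      where

      renderKinds : ∀ i x t l → (∀ c → block (fromCell l c) ≡ render i x (t c)) →
                    concat (tabulate λ c → block (G ↑ʳ combine {L} {C} l c))
                      ≡ render i x (overKinds t)
      renderKinds i x t l h = trans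
        (concat-tabulate-cong {n = C} λ c → trans
          (cong (λ c → block (G ↑ʳ combine {L} {C} l c))
            (sym (Inverse.strictlyInverseˡ (proj₂ Kind-finite) c)))
          (h (kindAt c)))
        (sym (render-concat i x (λ c → t (kindAt c))))

      blocks-render : concat (tabulate block) ≡
        render 0 x₀ (overFixed tF) ++ render 0 x₁ (overKinds tB) ++
        layers (λ i x → render i x (overKinds tM)) m 0 r ++ render m (symbolAt m r) (overKinds tT)
      blocks-render = begin
        concat (tabulate block)
          ≡⟨ concat-tabulate-+ G {L ℕ.* C} block ⟩
        concat (tabulate {n = G} λ g → block (g ↑ˡ (L ℕ.* C))) ++
          concat (tabulate λ i → block (_↑ʳ_ {L ℕ.* C} G i))
          ≡⟨ cong₂ _++_ fixed-part (concat-tabulate-* L {C} (λ i → block (G ↑ʳ i))) ⟩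
        render 0 x₀ (overFixed tF) ++ concat (tabulate layer)
          ≡⟨ cong (λ s → render 0 x₀ (overFixed tF) ++ s)
            (cong₂ _++_ (renderKinds 0 x₁ tB zero hB) upper) ⟩
        render 0 x₀ (overFixed tF) ++ render 0 x₁ (overKinds tB) ++
          layers (λ i x → render i x (overKinds tM)) m 0 r ++
          render m (symbolAt m r) (overKinds tT) ∎
        where
        open ≡-Reasoning

        layer : Fin L → List Symbol
        layer i = concat (tabulate λ c → block (G ↑ʳ combine {L} {C} i c))

        fixed-part : concat (tabulate {n = G} λ g → block (g ↑ˡ (L ℕ.* C)))
          ≡ render 0 x₀ (overFixed tF)
        fixed-part = trans
          (concat-tabulate-cong {n = G} λ g → trans
            (cong (λ g → block (g ↑ˡ (L ℕ.* C)))
              (sym (Inverse.strictlyInverseˡ (proj₂ Fixed-finite) g)))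
            (hF (fixedAt g)))
          (sym (render-concat 0 x₀ (λ g → tF (fixedAt g))))

        upper : concat (tabulate (layer ∘ suc)) ≡
                layers (λ i x → render i x (overKinds tM)) m 0 r ++
                render m (symbolAt m r) (overKinds tT)
        upper = trans (concat-tabulate-last m (layer ∘ suc)) (cong₂ _++_
          (trans (concat-tabulate-cong {n = m} λ i →
            renderKinds (toℕ i) (symbolAt (toℕ i) r) tM (suc (inject₁ i)) (hM i))
                 (layers-tabulate (λ i x → render i x (overKinds tM)) m 0 r))
          (renderKinds m (symbolAt m r) tT (suc (fromℕ m)) hT))

    module _ (w : List (Fin k)) where
      open Game (automaton w) using (gameInstance)

      sink-index : ∀ i → toℕ (fromFixed (inj₁ false)) ≡ offset (known false) ℕ.+ i ℕ.* 0
      sink-index i = trans (toℕ-fromFixed (inj₁ false)) (offset-raise i (known false))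

      nondet-encoded : ∀ α i x a → toℕ α ≡ offset a ℕ.+ i ℕ.* stride a →
        Holds w 0 (decode α) ≡ initially a x →
                       encodeNondet gameInstance α ≡ render i x (nondetBlock a)
      nondet-encoded α i x a index base = cong₂ _∷_ (cong (λ b → bit (if b then 1F else 0F)) base)
        (sym (trans (render-++ i x (transitions (sinkMove [])) (transitions (choiceMove a)))
          (cong₂ _++_
          (sym (render-transitions i x (sinkMove []) λ _ →
            render-move i x stay nondet (offset (known false)) 0 [] (sink-index i)))
          (sym (render-transitions i x (choiceMove a) λ v →
            render-move i x stay probab (suc (suc V ℕ.* offset a ℕ.+ toℕ v)) (suc V ℕ.* stride a) []
              (cong suc (choice-index v)))))))
        where
        open ℕ-Solver

        choice-index : ∀ v →
          toℕ (combine α v) ≡ suc V ℕ.* offset a ℕ.+ toℕ v ℕ.+ i ℕ.* (suc V ℕ.* stride a)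
        choice-index v = trans (toℕ-combine α v) (trans (cong (λ n → suc V ℕ.* n ℕ.+ toℕ v) index)
          (solve 5 (λ n o i s v → n :* (o :+ i :* s) :+ v := n :* o :+ v :+ i :* (n :* s)) refl
             (suc V) (offset a) i (stride a) (toℕ v)))

      prob-encoded : ∀ α v i x a →
        (∀ κ → toℕ (encode (premise (decode α) (viewAt v) κ))
        ≡ offset (a κ) ℕ.+ i ℕ.* stride (a κ)) →
                     encodeProb gameInstance (suc (combine α v)) ≡ render i x (probBlock a)
      prob-encoded α v i x a index = cong (bit 0F ∷_)
        (sym (trans (render-++ i x (transitions (sinkMove (encodeℚ (share 0))))
          (transitions (demandMove a))) (cong₂ _++_
          (sym (render-transitions i x (sinkMove (encodeℚ (share 0))) λ _ →
            render-move i x stay nondet (offset (known false)) 0 (encodeℚ (share 0))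
              (sink-index i)))
          (sym (render-transitions i x (demandMove a) λ κ →
            render-move i x down nondet (offset (a κ)) (stride (a κ)) (encodeℚ (share (suc tapes)))
              (trans (cong (λ p → toℕ (demanded p κ)) (remQuot-combine α v)) (index κ)))))))
        where
        demanded : Fin (G ℕ.+ L ℕ.* C) × Fin (suc V) → Fin (suc (suc tapes)) → Fin (G ℕ.+ L ℕ.* C)
        demanded (α , v) κ = encode (premise (decode α) (viewAt v) κ)

      probs-encoded : ∀ α i x (a : View → Fin (suc (suc tapes)) → Atom) →
        (∀ v κ → toℕ (encode (premise (decode α) v κ)) ≡ offset (a v κ) ℕ.+ i ℕ.* stride (a v κ)) →
        concat (tabulate λ v → encodeProb gameInstance (suc (combine α v)))
          ≡ render i x (probBlocks a)
      probs-encoded α i x a index = trans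
        (concat-tabulate-cong λ v → prob-encoded α v i x (a (viewAt v)) (index (viewAt v)))
        (sym (render-concat i x λ v → probBlock (a (viewAt v))))

      start-encoded : encodeProb gameInstance zero ≡ render 0 nothing startBlock
      start-encoded = cong (bit 0F ∷_) (sym (trans
        (render-++ 0 nothing (transitions startMove) (transitions startMove))
        (cong₂ _++_
          (sym (render-transitions 0 nothing startMove (encoded fromStep₀ up stay refl refl)))
          (sym (render-transitions 0 nothing startMove (encoded id up stay refl refl))))))
        where
        encoded : ∀ {S : Set} (toStep : S → Step₊) u t → toStep u ≡ up → toStep t ≡ stay → ∀ i →
          (let s , q = at (Game.startMoves (automaton w) u t) i in
             sign (toStep s) ∷ encodeLocation gameInstance q ++ encodeℚ (share 1))
               ≡ render 0 nothing (startMove i)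
        encoded _ _ _ eq _ 0F
          rewrite eq = render-move 0 nothing up probab 0 0 (encodeℚ (share 1)) refl
        encoded _ _ _ _ eq 1F
          rewrite eq = render-move 0 nothing stay nondet (offset okay) 0 (encodeℚ (share 1))
          (trans (toℕ-fromFixed (inj₂ (inj₁ tt))) (sym (ℕ.+-identityʳ _)))

      -- Initially the head scans the first input symbol, the second one lies in the bottom layer,
      -- and the layers above meet the rest. Hence the input left for them is `others (others w)`.
      instance-encoded : encodeInstance gameInstance ≡
        (render 0 (firstSymbol w) nondetFixed ++
         render 0 (firstSymbol (others w)) (nondetLayer 0) ++
         layers (λ i x → render i x (nondetLayer 1)) m 0 (others (others w)) ++
         render m (symbolAt m (others (others w))) (nondetLayer 1)) ∷ʳ end ++
        (render 0 nothing startBlock ++ render 0 nothing probFixed ++ render 0 nothing probBottom ++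
         layers (λ i x → render i x probMiddle) m 0 [] ++
         render m (symbolAt {Fin k} m []) probTop) ∷ʳ end ++
        probab ∷ sep ∷ []
      instance-encoded = cong₂ (λ s t → s ∷ʳ end ++ t ∷ʳ end ++ probab ∷ sep ∷ []) nondets
        (cong₂ _++_ start-encoded
          (trans (concat-tabulate-* (G ℕ.+ L ℕ.* C) (λ m → encodeProb gameInstance (suc m))) probs))
        where
        below : ∀ n i a → Below n a → n ℕ.+ i ℕ.≤ L →
          toℕ (encode (raise i a)) ≡ offset a ℕ.+ i ℕ.* stride a
        below n i a a<n n+i≤L =
          trans (toℕ-encode (n ℕ.+ i) (raise i a) (Below-raise n i a a<n) n+i≤L) (offset-raise i a)

        ground : ∀ n a → Below n a → n ℕ.≤ L → toℕ (encode a) ≡ offset a ℕ.+ 0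
        ground n a a<n n≤L = trans (toℕ-encode n a a<n n≤L) (sym (ℕ.+-identityʳ _))

        layer-index : ∀ i d c j → d ℕ.+ j ≡ toℕ i →
          toℕ (fromCell i c) ≡ offset (cell d c) ℕ.+ j ℕ.* C
        layer-index i d c j eq =
          trans (toℕ-fromCell i c)
          (trans (cong (λ i → offset (cell i c)) (sym eq)) (offset-raise j (cell d c)))

        layer-base : ∀ i d c x → symbolAt (suc (toℕ i)) w ≡ x →
          Holds w 0 (decode (fromCell i c)) ≡ initially (cell d c) x
        layer-base i d c x eq = trans (cong (Holds w 0) (decode-cell i c))
          (trans (Holds-initially-cell w (toℕ i) d c) (cong (initially (cell d c)) eq))

        nondets = blocks-render (encodeNondet gameInstance) (firstSymbol w) (firstSymbol (others w))
          (others (others w))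
          (λ f → nondetBlock (fixed f)) (λ c → nondetBlock (cell 0 c))
          (λ c → nondetBlock (cell 1 c)) (λ c → nondetBlock (cell 1 c))
          (λ f → nondet-encoded (fromFixed f) 0 (firstSymbol w) (fixed f)
             (trans (toℕ-fromFixed f) (sym (ℕ.+-identityʳ _)))
             (trans (cong (Holds w 0) (decode-fixed f)) (Holds-initially-fixed w f)))
          (λ c → nondet-encoded (fromCell zero c) 0 (firstSymbol (others w)) (cell 0 c)
             (layer-index zero 0 c 0 refl) (layer-base zero 0 c _ refl))
          (λ i c → nondet-encoded (fromCell (suc (inject₁ i)) c) (toℕ i)
            (symbolAt (toℕ i) (others (others w))) (cell 1 c)
             (layer-index (suc (inject₁ i)) 1 c (toℕ i) (cong suc (sym (Fin.toℕ-inject₁ i))))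
             (layer-base (suc (inject₁ i)) 1 c _
               (cong (λ i → symbolAt i (others (others w))) (Fin.toℕ-inject₁ i))))
          (λ c → nondet-encoded (fromCell (suc (fromℕ m)) c) m (symbolAt m (others (others w)))
            (cell 1 c)
             (layer-index (suc (fromℕ m)) 1 c m (cong suc (sym (Fin.toℕ-fromℕ m))))
             (layer-base (suc (fromℕ m)) 1 c _
               (cong (λ i → symbolAt i (others (others w))) (Fin.toℕ-fromℕ m))))

        at-fixed : ∀ f v κ → toℕ (encode (premise (decode (fromFixed f)) v κ))
          ≡ offset (premise (fixed f) v κ) ℕ.+ 0
        at-fixed f v κ = trans (cong (λ a → toℕ (encode (premise a v κ))) (decode-fixed f))
          (ground 1 _ (premise-fixed-below f v κ) (s≤s z≤n))

        at-cell : ∀ i j c v κ → toℕ i ≡ suc j →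
          toℕ (encode (premise (decode (fromCell i c)) v κ))
            ≡ toℕ (encode (raise j (premise (cell 1 c) v κ)))
        at-cell i j c v κ eq = cong (toℕ ∘ encode) (trans
          (cong (λ a → premise a v κ) (trans (decode-cell i c) (cong (λ i → cell i c) eq)))
          (premise-raise j c v κ))

        at-bottom : ∀ c v κ → toℕ (encode (premise (decode (fromCell zero c)) v κ))
          ≡ offset (premise (cell 0 c) v κ) ℕ.+ 0
        at-bottom c v κ = trans (cong (λ a → toℕ (encode (premise a v κ))) (decode-cell zero c))
          (ground 2 _ (premise-cell-below 0 c v κ) (s≤s (s≤s z≤n)))

        probs = blocks-render
          (λ α → concat (tabulate λ v → encodeProb gameInstance (suc (combine α v))))
          nothing nothing []
          (λ f → probBlocks (premise (fixed f))) (λ c → probBlocks (premise (cell 0 c)))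
          (λ c → probBlocks (premise (cell 1 c)))
          (λ c → probBlocks (λ v κ → clip (premise (cell 1 c) v κ)))
          (λ f → probs-encoded (fromFixed f) 0 nothing (premise (fixed f)) (at-fixed f))
          (λ c → probs-encoded (fromCell zero c) 0 nothing (premise (cell 0 c)) (at-bottom c))
          (λ i c → probs-encoded (fromCell (suc (inject₁ i)) c) (toℕ i) _
            (premise (cell 1 c)) λ v κ →
             trans (at-cell (suc (inject₁ i)) (toℕ i) c v κ (cong suc (Fin.toℕ-inject₁ i)))
                   (below 3 (toℕ i) (premise (cell 1 c) v κ) (premise-cell-below 1 c v κ)
                     (s≤s (s≤s (Fin.toℕ<n i)))))
          (λ c → probs-encoded (fromCell (suc (fromℕ m)) c) m _
            (λ v κ → clip (premise (cell 1 c) v κ)) λ v κ →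
             trans (at-cell (suc (fromℕ m)) m c v κ (cong suc (Fin.toℕ-fromℕ m)))
               (toℕ-encode-top (premise (cell 1 c) v κ)))

-- Structured programs on multitape machines, with unary counters

module Programs (Γ : Set) (Γ-finite : Finite Γ) (r : ℕ) (Δ : Set) where

  Symbols Actions : Set
  Symbols = Vec (Maybe Γ) (suc r)
  Actions = Vec (Maybe Γ × Shift) (suc r)

  -- The test of a loop also says which actions precede its body.
  data Program : Set where
    basic : (Symbols → Actions × Maybe Δ) → Program
    _⨾_   : Program → Program → Program
    while : (Symbols → Maybe Actions) → Program → Program

  infixr 5 _⨾_

  Point : Program → Set
  Point (basic _)   = ⊤
  Point (p ⨾ q)     = Point p ⊎ Point q
  Point (while _ p) = ⊤ ⊎ Point p

  Point-finite : ∀ p → Finite (Point p)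
  Point-finite (basic _)   = ⊤-finite
  Point-finite (p ⨾ q)     = Point-finite p ⊎-finite Point-finite q
  Point-finite (while _ p) = ⊤-finite ⊎-finite Point-finite p

  entry : ∀ p → Point p
  entry (basic _)   = tt
  entry (p ⨾ q)     = inj₁ (entry p)
  entry (while _ p) = inj₁ tt

  idle : Symbols → Actions
  idle = Vec.map (_, stay)

  tested : ∀ {t} p → Symbols → Maybe Actions → Maybe (Point (while t p)) × Actions × Maybe Δ
  tested p xs nothing   = nothing , idle xs , nothing
  tested p xs (just as) = just (inj₂ (entry p)) , as , nothing

  -- A next point `nothing` means completion. The enclosing program redirects it to the second half
  -- or back to the loop test within the same step.
  advance : ∀ p → Point p → Symbols → Maybe (Point p) × Actions × Maybe Δ
  advance (basic f)   _        xs = nothing , f xs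
  advance (p ⨾ q)     (inj₁ s) xs = map₁ (just ∘ maybe′ inj₁ (inj₂ (entry q))) (advance p s xs)
  advance (p ⨾ q)     (inj₂ s) xs = map₁ (Maybe.map inj₂) (advance q s xs)
  advance (while t p) (inj₁ _) xs = tested {t} p xs (t xs)
  advance (while t p) (inj₂ s) xs = map₁ (just ∘ maybe′ inj₂ (inj₁ tt)) (advance p s xs)

  machine : ∀ {Σ} → (Σ → Γ) → Program → TM Σ Δ
  machine inputSymbol p = record
    { State        = Maybe (Point p)
    ; Γ            = Γ
    ; State-finite = Maybe-finite (Point-finite p)
    ; Γ-finite     = Γ-finite
    ; inputSymbol  = inputSymbol
    ; extraTapes   = r
    ; start        = just (entry p)
    ; accepting    = λ _ → false
    ; δ            = λ { nothing _ → nothing ; (just s) xs → just (advance p s xs) }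
    }

  Tapes : Set
  Tapes = Vec (Tape Γ) (suc r)

  heads : ∀ {m} → Vec (Tape Γ) m → Vec (Maybe Γ) m
  heads = Vec.map Tape.head

  data Exec (p : Program) : Maybe (Point p) → Tapes → List Δ → ℕ → Tapes → Set where
    done : ∀ {ts} → Exec p nothing ts [] 0 ts
    step : ∀ {s ts out n ts′} → let s′ , as , o = advance p s (heads ts) in
           Exec p s′ (Vec.zipWith act as ts) out n ts′ →
             Exec p (just s) ts (fromMaybe o ++ out) (suc n) ts′

  step-≡ : ∀ {p s ts out n ts′ result} → advance p s (heads ts) ≡ result →
           let s′ , as , o = result in
           Exec p s′ (Vec.zipWith act as ts) out n ts′ →
             Exec p (just s) ts (fromMaybe o ++ out) (suc n) ts′
  step-≡ refl e = step e

  Runs : Program → Tapes → List Δ → ℕ → Tapes → Set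
  Runs p = Exec p (just (entry p))

  module _ {Σ : Set} (inputSymbol : Σ → Γ) (p : Program) where
    open TM (machine inputSymbol p) using (⟨_,_,_⟩; run)

    Exec-run : ∀ {s ts out n ts′} → Exec p s ts out n ts′ → ∀ o →
      run n ⟨ s , ts , o ⟩ ≡ ⟨ nothing , ts′ , o ++ out ⟩
    Exec-run done o = cong (λ o → ⟨ nothing , _ , o ⟩) (sym (List.++-identityʳ o))
    Exec-run (step {s} {ts} {out} e) o = trans (Exec-run e _)
      (cong (λ o → ⟨ nothing , _ , o ⟩)
        (List.++-assoc o (fromMaybe (proj₂ (proj₂ (advance p s (heads ts))))) out))

    run-halted : ∀ n ts o → run n ⟨ nothing , ts , o ⟩ ≡ ⟨ nothing , ts , o ⟩
    run-halted zero    ts o = refl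
    run-halted (suc n) ts o = run-halted n ts o

    run-+ : ∀ m n c → run (m ℕ.+ n) c ≡ run n (run m c)
    run-+ zero    n c = refl
    run-+ (suc m) n c = run-+ m n _

    -- A halted configuration does not change, so an upper bound on the time is as good as the exact
    -- time.
    Exec-run-≤ : ∀ {s ts out n ts′ N} → Exec p s ts out n ts′ → n ℕ.≤ N →
      run N ⟨ s , ts , [] ⟩ ≡ ⟨ nothing , ts′ , out ⟩
    Exec-run-≤ {s} {ts} {out} {n} {ts′} {N} e n≤N = begin
      run N ⟨ s , ts , [] ⟩
        ≡⟨ cong (λ N → run N ⟨ s , ts , [] ⟩) (ℕ.m+[n∸m]≡n n≤N) ⟨
      run (n ℕ.+ (N ℕ.∸ n)) ⟨ s , ts , [] ⟩      ≡⟨ run-+ n (N ℕ.∸ n) _ ⟩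
      run (N ℕ.∸ n) (run n ⟨ s , ts , [] ⟩)      ≡⟨ cong (run (N ℕ.∸ n)) (Exec-run e []) ⟩
      run (N ℕ.∸ n) ⟨ nothing , ts′ , out ⟩      ≡⟨ run-halted (N ℕ.∸ n) ts′ out ⟩
      ⟨ nothing , ts′ , out ⟩                    ∎
      where open ≡-Reasoning

  module _ {p q : Program} where
    private
      left-point : Maybe (Point p) → Maybe (Point (p ⨾ q))
      left-point = just ∘ maybe′ inj₁ (inj₂ (entry q))

    Exec-right : ∀ {s ts out n ts′} → Exec q s ts out n ts′ →
      Exec (p ⨾ q) (Maybe.map inj₂ s) ts out n ts′
    Exec-right done     = done
    Exec-right (step e) = step (Exec-right e)

    Exec-left : ∀ {s ts o₁ m ts₁ o₂ n ts₂} → Exec p s ts o₁ m ts₁ → Runs q ts₁ o₂ n ts₂ →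
                Exec (p ⨾ q) (left-point s) ts (o₁ ++ o₂) (m ℕ.+ n) ts₂
    Exec-left done e₂ = Exec-right e₂
    Exec-left (step {s} {ts} {out} e) e₂ =
      subst (λ o → Exec (p ⨾ q) _ _ o _ _)
        (sym (List.++-assoc (fromMaybe (proj₂ (proj₂ (advance p s (heads ts))))) out _))
        (step (Exec-left e e₂))

  module _ {t : Symbols → Maybe Actions} {p : Program} where
    private
      body-point : Maybe (Point p) → Maybe (Point (while t p))
      body-point = just ∘ maybe′ inj₂ (inj₁ tt)

    Exec-body : ∀ {s ts o₁ m ts₁ o₂ n ts₂} → Exec p s ts o₁ m ts₁ → Runs (while t p) ts₁ o₂ n ts₂ →
                Exec (while t p) (body-point s) ts (o₁ ++ o₂) (m ℕ.+ n) ts₂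
    Exec-body done e₂ = e₂
    Exec-body (step {s} {ts} {out} e) e₂ =
      subst (λ o → Exec (while t p) _ _ o _ _)
        (sym (List.++-assoc (fromMaybe (proj₂ (proj₂ (advance p s (heads ts))))) out _))
        (step (Exec-body e e₂))

    Runs-exit : ∀ {ts} → t (heads ts) ≡ nothing →
      Runs (while t p) ts [] 1 (Vec.zipWith act (idle (heads ts)) ts)
    Runs-exit {ts} eq = step-≡ (cong (tested {t} p (heads ts)) eq) done

    Runs-enter : ∀ {ts as o₁ m ts₁ o₂ n ts₂} → t (heads ts) ≡ just as →
                 Runs p (Vec.zipWith act as ts) o₁ m ts₁ → Runs (while t p) ts₁ o₂ n ts₂ →
                 Runs (while t p) ts (o₁ ++ o₂) (suc (m ℕ.+ n)) ts₂
    Runs-enter {ts} eq e₁ e₂ = step-≡ (cong (tested {t} p (heads ts)) eq) (Exec-body e₁ e₂)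

-- All tapes but the first are unary counters: cell 0 carries the mark zero and
-- the value is the position of the head.
module Counters (k r : ℕ) (Δ : Set) where

  open Programs (Fin (suc k)) (Fin-finite (suc k)) r Δ public

  Store : Set
  Store = List (Fin k) × Vec ℕ r

  -- Input symbols are shifted by one because `zero` is the mark. The input head never moves left,
  -- so the part `l` already passed may be arbitrary.
  inputTape : List (Maybe (Fin (suc k))) → List (Fin k) → Tape (Fin (suc k))
  inputTape l u = tape l (Maybe.map suc (firstSymbol u)) (List.map just (List.map suc (others u)))

  -- The `e` blanks are cells recorded when the counter was larger; they do not affect its value.
  data Counter : ℕ → Tape (Fin (suc k)) → Set where
    zero : ∀ {e} → Counter 0 (tape [] (just zero) (replicate e nothing))
    suc  : ∀ {v e} → Counter (suc v)
      (tape (replicate v nothing ++ [ just zero ]) nothing (replicate e nothing))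

  data Counters : ∀ {m} → Vec ℕ m → Vec (Tape (Fin (suc k))) m → Set where
    []  : Counters [] []
    _∷_ : ∀ {m v t} {vs : Vec ℕ m} {ts} → Counter v t → Counters vs ts → Counters (v ∷ vs) (t ∷ ts)

  data Represents : Store → Tapes → Set where
    _∷_ : ∀ {u vs t ts} → (∃[ l ] t ≡ inputTape l u) → Counters vs ts → Represents (u , vs) (t ∷ ts)

  data CounterMove : Shift → ℕ → ℕ → Set where
    keep : ∀ {v} → CounterMove stay v v
    inc  : ∀ {v} → CounterMove right v (suc v)
    dec  : ∀ {v} → CounterMove left (suc v) v

  data CounterMoves : ∀ {m} → Vec Shift m → Vec ℕ m → Vec ℕ m → Set where
    []  : CounterMoves [] [] []
    _∷_ : ∀ {m d v v′} {ds : Vec Shift m} {vs vs′} → CounterMove d v v′ → CounterMoves ds vs vs′ →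
          CounterMoves (d ∷ ds) (v ∷ vs) (v′ ∷ vs′)

  data InputMove : Shift → List (Fin k) → List (Fin k) → Set where
    keep : ∀ {u} → InputMove stay u u
    next : ∀ {x u} → InputMove right (x ∷ u) u

  data Moves : Vec Shift (suc r) → Store → Store → Set where
    _∷_ : ∀ {d ds u u′ vs vs′} → InputMove d u u′ → CounterMoves ds vs vs′ →
      Moves (d ∷ ds) (u , vs) (u′ , vs′)

  counterHead : ℕ → Maybe (Fin (suc k))
  counterHead zero    = just zero
  counterHead (suc _) = nothing

  scan : Store → Symbols
  scan (u , vs) = Maybe.map suc (firstSymbol u) ∷ Vec.map counterHead vs

  moving : Vec Shift (suc r) → Symbols → Actions
  moving ds xs = Vec.zipWith _,_ xs ds

  counters-heads : ∀ {m vs} {ts : Vec _ m} → Counters vs ts → heads ts ≡ Vec.map counterHead vs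
  counters-heads []           = refl
  counters-heads (zero ∷ cs)  = cong (_ ∷_) (counters-heads cs)
  counters-heads (suc ∷ cs)   = cong (_ ∷_) (counters-heads cs)

  represents-heads : ∀ {st ts} → Represents st ts → heads ts ≡ scan st
  represents-heads ((_ , refl) ∷ cs) = cong (_ ∷_) (counters-heads cs)

  counter-shift : ∀ {d v v′ t} → CounterMove d v v′ → Counter v t → Counter v′ (shift d t)
  counter-shift keep c = c
  counter-shift inc (zero {zero})    = suc {v = 0} {e = 0}
  counter-shift inc (zero {suc e})   = suc {v = 0} {e = e}
  counter-shift inc (suc {v} {zero})  = suc {v = suc v} {e = 0}
  counter-shift inc (suc {v} {suc e}) = suc {v = suc v} {e = e}
  counter-shift dec (suc {zero} {e})  = zero {e = suc e}
  counter-shift dec (suc {suc v} {e}) = suc {v = v} {e = suc e}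

  counters-shift : ∀ {m ds vs vs′} {ts : Vec _ m} → CounterMoves ds vs vs′ → Counters vs ts →
                   Counters vs′ (Vec.zipWith act (Vec.zipWith _,_ (heads ts) ds) ts)
  counters-shift []       []       = []
  counters-shift (m ∷ ms) (c ∷ cs) = counter-shift m c ∷ counters-shift ms cs

  input-shift : ∀ {d u u′} → InputMove d u u′ → ∀ l →
                ∃[ l′ ] shift d (inputTape l u) ≡ inputTape l′ u′
  input-shift keep               l = l , refl
  input-shift (next {x} {[]})    l = just (suc x) ∷ l , refl
  input-shift (next {x} {_ ∷ _}) l = just (suc x) ∷ l , refl

  represents-moving : ∀ {ds st st′ ts} → Moves ds st st′ → Represents st ts →
                      Represents st′ (Vec.zipWith act (moving ds (heads ts)) ts)
  represents-moving (m ∷ ms) ((l , refl) ∷ cs) = input-shift m l ∷ counters-shift ms cs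

  record Outcome (p : Program) (ts : Tapes) (out : List Δ) (bound : ℕ) (st′ : Store) : Set where
    constructor outcome
    field
      {tapes′}   : Tapes
      {time}     : ℕ
      time≤      : time ℕ.≤ bound
      runs       : Runs p ts out time tapes′
      represents : Represents st′ tapes′

  -- A store does not determine the tapes, so a specification covers all tapes representing it and
  -- bounds the time instead of fixing it.
  Performs : Program → Store → List Δ → ℕ → Store → Set
  Performs p st out bound st′ = ∀ {ts} → Represents st ts → Outcome p ts out bound st′

  weaken : ∀ {p st out b b′ st′} → Performs p st out b st′ → b ℕ.≤ b′ → Performs p st out b′ st′
  weaken h b≤b′ rs with h rs
  ... | outcome t≤b e rs′ = outcome (ℕ.≤-trans t≤b b≤b′) e rs′

  basic-performs : ∀ {f st st′ ds o} → f (scan st) ≡ (moving ds (scan st) , o) → Moves ds st st′ →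
                   Performs (basic f) st (fromMaybe o) 1 st′
  basic-performs {f} {st} {st′} {ds} {o} eq ms {ts} rs = outcome ℕ.≤-refl
    (subst (λ o → Runs (basic f) ts o 1 _) (List.++-identityʳ (fromMaybe o))
      (step-≡ {p = basic f} (cong (nothing ,_) eq′) done))
    (represents-moving ms rs)
    where
    eq′ : f (heads ts) ≡ (moving ds (heads ts) , o)
    eq′ = subst (λ xs → f xs ≡ (moving ds xs , o)) (sym (represents-heads rs)) eq

  ⨾-performs : ∀ {p q st o₁ b₁ st₁ o₂ b₂ st₂} → Performs p st o₁ b₁ st₁ → Performs q st₁ o₂ b₂ st₂ →
               Performs (p ⨾ q) st (o₁ ++ o₂) (b₁ ℕ.+ b₂) st₂
  ⨾-performs hp hq rs with hp rs
  ... | outcome t₁ e₁ rs₁ with hq rs₁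
  ... | outcome t₂ e₂ rs₂ = outcome (ℕ.+-mono-≤ t₁ t₂) (Exec-left e₁ e₂) rs₂

  while-exit : ∀ {t p st} → t (scan st) ≡ nothing → Performs (while t p) st [] 1 st
  while-exit {t} {p} {st} eq {ts} rs = outcome ℕ.≤-refl
    (Runs-exit (subst (λ xs → t xs ≡ nothing) (sym (represents-heads rs)) eq))
    (subst (Represents st) (sym (idling ts)) rs)
    where
    idling : ∀ {m} (ts : Vec (Tape (Fin (suc k))) m) →
      Vec.zipWith act (Vec.map (_, stay) (heads ts)) ts ≡ ts
    idling []       = refl
    idling (t ∷ ts) = cong (t ∷_) (idling ts)

  while-enter : ∀ {t p st ds st₁ o₁ b₁ st₂ o₂ b₂ st₃} → t (scan st) ≡ just (moving ds (scan st)) →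
    Moves ds st st₁ →
                Performs p st₁ o₁ b₁ st₂ → Performs (while t p) st₂ o₂ b₂ st₃ →
                Performs (while t p) st (o₁ ++ o₂) (suc (b₁ ℕ.+ b₂)) st₃
  while-enter {t} {ds = ds} eq ms hp hw rs with hp (represents-moving ms rs)
  ... | outcome t₁ e₁ rs₁ with hw rs₁
  ... | outcome t₂ e₂ rs₂ = outcome (s≤s (ℕ.+-mono-≤ t₁ t₂))
    (Runs-enter (subst (λ xs → t xs ≡ just (moving ds xs)) (sym (represents-heads rs)) eq) e₁ e₂)
      rs₂

  steady : ∀ {m} → Vec Shift m
  steady = Vec.replicate _ stay

  steady-moves : ∀ {m} (vs : Vec ℕ m) → CounterMoves steady vs vs
  steady-moves []       = []
  steady-moves (v ∷ vs) = keep ∷ steady-moves vs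

  inc-moves : ∀ {m} c (vs : Vec ℕ m) → CounterMoves (steady [ c ]≔ right) vs (updateAt vs c suc)
  inc-moves zero    (v ∷ vs) = inc ∷ steady-moves vs
  inc-moves (suc c) (v ∷ vs) = keep ∷ inc-moves c vs

  dec-moves : ∀ {m} c (vs : Vec ℕ m) {v} → lookup vs c ≡ suc v →
    CounterMoves (steady [ c ]≔ left) vs (vs [ c ]≔ v)
  dec-moves zero    (_ ∷ vs) refl = dec ∷ steady-moves vs
  dec-moves (suc c) (v ∷ vs) eq   = keep ∷ dec-moves c vs eq

  skip : Program
  skip = basic λ xs → moving steady xs , nothing

  emit : Δ → Program
  emit s = basic λ xs → moving steady xs , just s

  incr : Fin r → Program
  incr c = basic λ xs → moving (stay ∷ (steady [ c ]≔ right)) xs , nothing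

  countdown : Fin r → Maybe (Fin (suc k)) → Symbols → Maybe Actions
  countdown c nothing  xs = just (moving (stay ∷ (steady [ c ]≔ left)) xs)
  countdown c (just _) xs = nothing

  loop : Fin r → Program → Program
  loop c = while λ xs → countdown c (lookup xs (suc c)) xs

  skip-performs : ∀ {st} → Performs skip st [] 1 st
  skip-performs {u , vs} = basic-performs {st = u , vs} refl (keep ∷ steady-moves vs)

  emit-performs : ∀ s {st} → Performs (emit s) st [ s ] 1 st
  emit-performs s {u , vs} = basic-performs {st = u , vs} refl (keep ∷ steady-moves vs)

  incr-performs : ∀ c {u vs} → Performs (incr c) (u , vs) [] 1 (u , updateAt vs c suc)
  incr-performs c {u} {vs} = basic-performs {st = u , vs} refl (keep ∷ inc-moves c vs)

  scan-counter : ∀ c u vs → lookup (scan (u , vs)) (suc c) ≡ counterHead (lookup vs c)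
  scan-counter c u vs = Vec.lookup-map c counterHead vs

  loop-exit : ∀ c {p u vs} → lookup vs c ≡ 0 → Performs (loop c p) (u , vs) [] 1 (u , vs)
  loop-exit c {p} {u} {vs} eq = while-exit {st = u , vs}
    (cong (λ x → countdown c x (scan (u , vs))) (trans (scan-counter c u vs) (cong counterHead eq)))

  loop-enter : ∀ c {p u vs v o₁ b₁ st₁ o₂ b₂ st₂} → lookup vs c ≡ suc v →
               Performs p (u , vs [ c ]≔ v) o₁ b₁ st₁ → Performs (loop c p) st₁ o₂ b₂ st₂ →
               Performs (loop c p) (u , vs) (o₁ ++ o₂) (suc (b₁ ℕ.+ b₂)) st₂
  loop-enter c {p} {u} {vs} eq = while-enter {st = u , vs} {ds = stay ∷ (steady [ c ]≔ left)}
    (cong (λ x → countdown c x (scan (u , vs))) (trans (scan-counter c u vs) (cong counterHead eq)))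
    (keep ∷ dec-moves c vs eq)

  emits : List Δ → Program
  emits = List.foldr (λ s p → emit s ⨾ p) skip

  emits-performs : ∀ s {st} → Performs (emits s) st s (suc (length s)) st
  emits-performs []      {st} = skip-performs {st}
  emits-performs (c ∷ s) {st} =
    weaken (⨾-performs (emit-performs c {st}) (emits-performs s {st})) ℕ.≤-refl

  incrs : Fin r → ℕ → Program
  incrs c zero    = skip
  incrs c (suc a) = incr c ⨾ incrs c a

-- Printing templates with five counters

-- Nested like the composition of `horner`, so that the bounds of its parts combine without
-- arithmetic: multiplication by the input length, transfer of the product, addition of the
-- coefficient.
hornerCost : Poly → ℕ → ℕ
hornerCost []       n = 1
hornerCost (a ∷ as) n = hornerCost as n ℕ.+
  ((eval as n ℕ.* suc ((n ℕ.* 3 ℕ.+ 1) ℕ.+ (n ℕ.* 2 ℕ.+ 1)) ℕ.+ 1) ℕ.+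
    ((eval as n ℕ.* n ℕ.* 2 ℕ.+ 1) ℕ.+ suc a))

module Printer (k : ℕ) where
  open Counters k 5 Symbol public

  -- `N` holds the number of input symbols passed and `I` the layer index; `X` holds the value under
  -- evaluation or the rounds left, and `J` and `Y` are scratch.
  pattern N = 0F
  pattern J = 1F
  pattern X = 2F
  pattern Y = 3F
  pattern I = 4F

  store : List (Fin k) → (n j x y i : ℕ) → Store
  store u n j x y i = u , n ∷ j ∷ x ∷ y ∷ i ∷ []

  ending : ∀ {p st o b st′ st″} → st′ ≡ st″ → Performs p st o b st′ → Performs p st o b st″
  ending refl h = h

  printing : ∀ {p st o o′ b st′} → o ≡ o′ → Performs p st o b st′ → Performs p st o′ b st′
  printing refl h = h

  transfer : ∀ c d {u} (S : ℕ → ℕ → Vec ℕ 5) → (∀ a b → lookup (S a b) c ≡ a) →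
             (∀ a b → S (suc a) b [ c ]≔ a ≡ S a b) →
             (∀ a b → updateAt (S a b) d suc ≡ S a (suc b)) →
             ∀ a b → Performs (loop c (incr d)) (u , S a b) [] (a ℕ.* 2 ℕ.+ 1) (u , S 0 (a ℕ.+ b))
  transfer c d S value lower raise zero b = loop-exit c (value 0 b)
  transfer c d {u} S value lower raise (suc a) b = loop-enter c (value (suc a) b)
    (subst₂ (λ vs vs′ → Performs (incr d) (u , vs) [] 1 (u , vs′)) (sym (lower a b)) (raise a b)
      (incr-performs d))
    (ending (cong (λ b → u , S 0 b) (ℕ.+-suc a b)) (transfer c d S value lower raise a (suc b)))

  module _ {u : List (Fin k)} {i : ℕ} where

    copy : ∀ n {j x y} →
      Performs (loop N (incr J ⨾ incr Y)) (store u n j x y i) [] (n ℕ.* 3 ℕ.+ 1)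
      (store u 0 (n ℕ.+ j) x (n ℕ.+ y) i)
    copy zero            = loop-exit N refl
    copy (suc n) {j} {x} {y} = loop-enter N refl
      (⨾-performs (incr-performs J) (incr-performs Y))
      (ending (cong₂ (λ j y → store u 0 j x y i) (ℕ.+-suc n j) (ℕ.+-suc n y)) (copy n))

    -- Reading a unary counter empties it, so `N` is moved to `Y` and `J` at once and then restored
    -- from `J`.
    addN : ∀ n {x y} → Performs (loop N (incr J ⨾ incr Y) ⨾ loop J (incr N)) (store u n 0 x y i) []
             ((n ℕ.* 3 ℕ.+ 1) ℕ.+ (n ℕ.* 2 ℕ.+ 1)) (store u n 0 x (n ℕ.+ y) i)
    addN n {x} {y} = ⨾-performs
      (ending (cong (λ j → store u 0 j x (n ℕ.+ y) i) (ℕ.+-identityʳ n)) (copy n))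
      (ending (cong (λ m → store u m 0 x (n ℕ.+ y) i) (ℕ.+-identityʳ n))
        (transfer J N (λ j n′ → n′ ∷ j ∷ x ∷ (n ℕ.+ y) ∷ i ∷ []) (λ _ _ → refl) (λ _ _ → refl)
          (λ _ _ → refl) n 0))

    multiply : ∀ n x {y} →
      Performs (loop X (loop N (incr J ⨾ incr Y) ⨾ loop J (incr N))) (store u n 0 x y i) []
      (x ℕ.* suc ((n ℕ.* 3 ℕ.+ 1) ℕ.+ (n ℕ.* 2 ℕ.+ 1)) ℕ.+ 1) (store u n 0 0 (x ℕ.* n ℕ.+ y) i)
    multiply n zero        = loop-exit X refl
    multiply n (suc x) {y} = weaken
      (loop-enter X refl (addN n)
        (ending (cong (λ y → store u n 0 0 y i)
          (solve 3 (λ x n y → x :* n :+ (n :+ y) := (n :+ x :* n) :+ y) refl x n y))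
          (multiply n x)))
      (ℕ.≤-reflexive (cong suc (sym (ℕ.+-assoc ((n ℕ.* 3 ℕ.+ 1) ℕ.+ (n ℕ.* 2 ℕ.+ 1)) _ 1))))
      where open ℕ-Solver

    addConstant : ∀ a {n x} →
      Performs (incrs X a) (store u n 0 x 0 i) [] (suc a) (store u n 0 (a ℕ.+ x) 0 i)
    addConstant zero        = skip-performs
    addConstant (suc a) {n} {x} = ⨾-performs (incr-performs X)
      (ending (cong (λ x → store u n 0 x 0 i) (ℕ.+-suc a x)) (addConstant a))

  mulAdd : ℕ → Program
  mulAdd a = loop X (loop N (incr J ⨾ incr Y) ⨾ loop J (incr N)) ⨾ loop Y (incr X) ⨾ incrs X a

  horner : Poly → Program
  horner []       = skip
  horner (a ∷ as) = horner as ⨾ mulAdd a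

  horner-performs : ∀ as {u} n {i} →
    Performs (horner as) (store u n 0 0 0 i) [] (hornerCost as n) (store u n 0 (eval as n) 0 i)
  horner-performs []       n = skip-performs
  horner-performs (a ∷ as) {u} n {i} = ⨾-performs (horner-performs as n) (⨾-performs
    (ending (cong (λ y → store u n 0 0 y i) (ℕ.+-identityʳ (e ℕ.* n))) (multiply n e))
    (⨾-performs
      (ending (cong (λ x → store u n 0 x 0 i) (trans (ℕ.+-identityʳ (e ℕ.* n)) (ℕ.*-comm e n)))
        (transfer Y X (λ y x → n ∷ 0 ∷ x ∷ y ∷ i ∷ []) (λ _ _ → refl) (λ _ _ → refl) (λ _ _ → refl)
          (e ℕ.* n) 0))
      (addConstant a)))
    where e = eval as n

  symbol : Maybe (Fin (suc k)) → Maybe (Fin k)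
  symbol (just (suc x)) = just x
  symbol _              = nothing

  symbol-suc : ∀ x → symbol (Maybe.map suc x) ≡ x
  symbol-suc nothing  = refl
  symbol-suc (just x) = refl

  piece : Piece (Fin k) → Program
  piece (lit s) = emit s
  piece (rep s) = loop I (incr J ⨾ emits s) ⨾ loop J (incr I)
  piece (inp f) = basic λ xs → moving steady xs , just (f (symbol (Vec.head xs)))

  -- A piece takes at most its weight times `suc i` steps. For `rep s`, a round costs `3 + length s`
  -- (test, increment, emission with its final `skip`) and restoring `I` costs 2 more.
  pieceWeight : Piece (Fin k) → ℕ
  pieceWeight (lit _) = 1
  pieceWeight (rep s) = 5 ℕ.+ length s
  pieceWeight (inp _) = 1

  template : List (Piece (Fin k)) → Program
  template = List.foldr (λ p q → piece p ⨾ q) skip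

  templateWeight : List (Piece (Fin k)) → ℕ
  templateWeight = List.foldr (λ p n → pieceWeight p ℕ.+ n) 1

  module _ {u : List (Fin k)} {n x y : ℕ} where

    repeat : ∀ s i {j} →
      Performs (loop I (incr J ⨾ emits s)) (store u n j x y i) (concat (replicate i s))
               (i ℕ.* (3 ℕ.+ length s) ℕ.+ 1) (store u n (i ℕ.+ j) x y 0)
    repeat s zero        = loop-exit I refl
    repeat s (suc i) {j} = weaken
      (loop-enter I refl (⨾-performs (incr-performs J) (emits-performs s))
        (ending (cong (λ j → store u n j x y 0) (ℕ.+-suc i j)) (repeat s i)))
      (ℕ.≤-reflexive (cong (3 ℕ.+_) (sym (ℕ.+-assoc (length s) (i ℕ.* (3 ℕ.+ length s)) 1))))

    piece-performs : ∀ p i → Performs (piece p) (store u n 0 x y i) (evalPiece i (firstSymbol u) p)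
                       (pieceWeight p ℕ.* suc i) (store u n 0 x y i)
    piece-performs (lit s) i = weaken (emit-performs s) (s≤s z≤n)
    piece-performs (inp f) i = weaken
      (printing (cong (λ x → [ f x ]) (symbol-suc (firstSymbol u)))
        (basic-performs refl (keep ∷ steady-moves _)))
      (s≤s z≤n)
    piece-performs (rep s) i = weaken
      (printing (List.++-identityʳ _) (⨾-performs
        (ending (cong (λ j → store u n j x y 0) (ℕ.+-identityʳ i)) (repeat s i))
        (ending (cong (λ i → store u n 0 x y i) (ℕ.+-identityʳ i))
          (transfer J I (λ j i → n ∷ j ∷ x ∷ y ∷ i ∷ []) (λ _ _ → refl) (λ _ _ → refl)
            (λ _ _ → refl) i 0))))
      (ℕ.≤-trans
        (ℕ.≤-reflexive (solve 2 (λ i l →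
          (i :* (con 3 :+ l) :+ con 1) :+ (i :* con 2 :+ con 1) := con 2 :+ i :* (con 5 :+ l)) refl
          i (length s)))
        (ℕ.≤-trans (ℕ.+-monoˡ-≤ (i ℕ.* (5 ℕ.+ length s)) (s≤s (s≤s (z≤n {3 ℕ.+ length s}))))
          (ℕ.≤-reflexive (ℕ.*-comm (suc i) (5 ℕ.+ length s)))))
      where open ℕ-Solver

    template-performs : ∀ ps i →
      Performs (template ps) (store u n 0 x y i) (render i (firstSymbol u) ps)
                          (templateWeight ps ℕ.* suc i) (store u n 0 x y i)
    template-performs []       i = weaken skip-performs (s≤s z≤n)
    template-performs (p ∷ ps) i = weaken (⨾-performs (piece-performs p i) (template-performs ps i))
      (ℕ.≤-reflexive (sym (ℕ.*-distribʳ-+ (suc i) (pieceWeight p) (templateWeight ps))))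

  whenInput : Maybe (Fin (suc k)) → Vec Shift 6
  whenInput nothing  = steady
  -- The second `right` moves the head of `N`, which thus counts the symbols passed.
  whenInput (just _) = right ∷ right ∷ steady

  readNext : Program
  readNext = basic λ xs → moving (whenInput (Vec.head xs)) xs , nothing

  arrived : List (Fin k) → ℕ → ℕ
  arrived []      n = n
  arrived (_ ∷ _) n = suc n

  readNext-performs : ∀ u {n j x y i} →
    Performs readNext (store u n j x y i) [] 1 (store (others u) (arrived u n) j x y i)
  readNext-performs []      = basic-performs refl (keep ∷ steady-moves _)
  readNext-performs (_ ∷ u) = basic-performs refl (next ∷ inc ∷ steady-moves _)

  ifInput : Symbols → Maybe (Fin (suc k)) → Maybe Actions
  ifInput xs nothing  = nothing
  ifInput xs (just _) = just (moving steady xs)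

  inputLoop sweep : List (Piece (Fin k)) → Program
  inputLoop t = while (λ xs → ifInput xs (Vec.head xs)) (template t ⨾ incr I ⨾ readNext)
  sweep t     = loop X (template t ⨾ incr I)

  layer : List (Piece (Fin k)) → ℕ → Maybe (Fin k) → List Symbol
  layer t i x = render i x t

  module _ (t : List (Piece (Fin k))) (M : ℕ) where

    template≤ : ∀ {i} → i ℕ.≤ M → templateWeight t ℕ.* suc i ℕ.≤ templateWeight t ℕ.* suc M
    template≤ i≤M = ℕ.*-monoʳ-≤ (templateWeight t) (s≤s i≤M)

    inputLoop-performs : ∀ u {n x y} i → length u ℕ.+ i ℕ.≤ M →
      Performs (inputLoop t) (store u n 0 x y i) (layers (layer t) (length u) i u)
      (length u ℕ.* (templateWeight t ℕ.* suc M ℕ.+ 3) ℕ.+ 1)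
        (store [] (length u ℕ.+ n) 0 x y (length u ℕ.+ i))
    inputLoop-performs []      i _ = while-exit refl
    inputLoop-performs (a ∷ u) {n} {x} {y} i h = weaken
      (printing (cong (_++ layers (layer t) (length u) (suc i) u)
        (List.++-identityʳ (render i (just a) t)))
        (while-enter refl (keep ∷ steady-moves _)
          (⨾-performs (template-performs t i)
            (⨾-performs (incr-performs I) (readNext-performs (a ∷ u))))
          (ending (cong₂ (λ n i → store [] n 0 x y i) (ℕ.+-suc (length u) n) (ℕ.+-suc (length u) i))
            (inputLoop-performs u (suc i) (subst (ℕ._≤ M) (sym (ℕ.+-suc (length u) i)) h)))))
      (ℕ.≤-trans (s≤s (ℕ.+-monoˡ-≤ _
        (ℕ.+-monoˡ-≤ 2 (template≤ (ℕ.≤-trans (ℕ.m≤n+m i (suc (length u))) h)))))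
        (ℕ.≤-reflexive (solve 2 (λ c r →
          con 1 :+ ((c :+ con 2) :+ (r :+ con 1)) := ((c :+ con 3) :+ r) :+ con 1) refl
          (templateWeight t ℕ.* suc M) (length u ℕ.* (templateWeight t ℕ.* suc M ℕ.+ 3)))))
      where open ℕ-Solver

    sweep-performs : ∀ c {n y} i → c ℕ.+ i ℕ.≤ M →
      Performs (sweep t) (store [] n 0 c y i) (layers (layer t) c i [])
      (c ℕ.* (templateWeight t ℕ.* suc M ℕ.+ 2) ℕ.+ 1) (store [] n 0 0 y (c ℕ.+ i))
    sweep-performs zero    i _ = loop-exit X refl
    sweep-performs (suc c) {n} {y} i h = weaken
      (printing (cong (_++ layers (layer t) c (suc i) []) (List.++-identityʳ (render i nothing t)))
        (loop-enter X refl
          (⨾-performs (template-performs t i) (incr-performs I))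
          (ending (cong (λ i → store [] n 0 0 y i) (ℕ.+-suc c i))
            (sweep-performs c (suc i) (subst (ℕ._≤ M) (sym (ℕ.+-suc c i)) h)))))
      (ℕ.≤-trans (s≤s (ℕ.+-monoˡ-≤ _ (ℕ.+-monoˡ-≤ 1 (template≤ (ℕ.≤-trans (ℕ.m≤n+m i (suc c)) h)))))
        (ℕ.≤-reflexive (solve 2 (λ c r →
          con 1 :+ ((c :+ con 1) :+ (r :+ con 1)) := ((c :+ con 2) :+ r) :+ con 1) refl
          (templateWeight t ℕ.* suc M) (c ℕ.* (templateWeight t ℕ.* suc M ℕ.+ 2)))))
      where open ℕ-Solver

-- Polynomial time bounds

IsPoly : (ℕ → ℕ) → Set
IsPoly f = ∃[ p ] ∀ n → f n ≡ eval p n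

constant-poly : ∀ c → IsPoly (λ _ → c)
constant-poly c = c ∷ [] , λ n → sym (trans (cong (c ℕ.+_) (ℕ.*-zeroʳ n)) (ℕ.+-identityʳ c))

identity-poly : IsPoly id
identity-poly = 0 ∷ 1 ∷ [] , solve 1 (λ n → n := con 0 :+ n :* (con 1 :+ n :* con 0)) refl
  where open ℕ-Solver

infixl 6 _+-poly_
infixl 7 _*-poly_

_+-poly_ : ∀ {f g} → IsPoly f → IsPoly g → IsPoly (λ n → f n ℕ.+ g n)
(p , f≡p) +-poly (q , g≡q) = add p q , λ n → trans (cong₂ ℕ._+_ (f≡p n) (g≡q n)) (eval-add p q n)
  where
  add : Poly → Poly → Poly
  add []      q       = q
  add (a ∷ p) []      = a ∷ p
  add (a ∷ p) (b ∷ q) = a ℕ.+ b ∷ add p q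

  open ℕ-Solver

  eval-add : ∀ p q n → eval p n ℕ.+ eval q n ≡ eval (add p q) n
  eval-add []      q       n = refl
  eval-add (a ∷ p) []      n = ℕ.+-identityʳ _
  eval-add (a ∷ p) (b ∷ q) n = trans
    (solve 5 (λ a b n x y → (a :+ n :* x) :+ (b :+ n :* y) := (a :+ b) :+ n :* (x :+ y)) refl a b n
      (eval p n) (eval q n))
    (cong (λ x → a ℕ.+ b ℕ.+ n ℕ.* x) (eval-add p q n))

scale-poly : ∀ {f} a → IsPoly f → IsPoly (λ n → a ℕ.* f n)
scale-poly a (p , f≡p) = List.map (a ℕ.*_) p , λ n → trans (cong (a ℕ.*_) (f≡p n)) (eval-scale p n)
  where
  open ℕ-Solver
  eval-scale : ∀ p n → a ℕ.* eval p n ≡ eval (List.map (a ℕ.*_) p) n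
  eval-scale []      n = ℕ.*-zeroʳ a
  eval-scale (b ∷ p) n = trans
    (solve 4 (λ a b n x → a :* (b :+ n :* x) := a :* b :+ n :* (a :* x)) refl a b n (eval p n))
    (cong (λ x → a ℕ.* b ℕ.+ n ℕ.* x) (eval-scale p n))

shift-poly : ∀ {f} → IsPoly f → IsPoly (λ n → n ℕ.* f n)
shift-poly (p , f≡p) = 0 ∷ p , λ n → cong (n ℕ.*_) (f≡p n)

_*-poly_ : ∀ {f g} → IsPoly f → IsPoly g → IsPoly (λ n → f n ℕ.* g n)
_*-poly_ {f} {g} (p , f≡p) q = let r , h = go p in r , λ n → trans (cong (ℕ._* g n) (f≡p n)) (h n)
  where
  open ℕ-Solver
  go : ∀ p → IsPoly (λ n → eval p n ℕ.* g n)
  go []      = constant-poly 0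
  go (a ∷ p) = let r , h = scale-poly a q +-poly shift-poly (go p) in r , λ n → trans
    (solve 4 (λ a n x y → (a :+ n :* x) :* y := a :* y :+ n :* (x :* y)) refl a n (eval p n) (g n))
      (h n)

horner-poly : ∀ as → IsPoly (hornerCost as)
horner-poly []       = constant-poly 1
horner-poly (a ∷ as) = horner-poly as +-poly
  ((e *-poly (constant-poly 1 +-poly
      ((n *-poly constant-poly 3 +-poly constant-poly 1) +-poly
       (n *-poly constant-poly 2 +-poly constant-poly 1)))
    +-poly constant-poly 1)
   +-poly ((e *-poly n *-poly constant-poly 2 +-poly constant-poly 1) +-poly constant-poly (suc a)))
  where
  n = identity-poly
  e : IsPoly (eval as)
  e = as , λ _ → refl

-- The printing machine and the reduction

-- The value of the polynomial is available only after the input has been read, and reading already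
-- prints one layer per remaining symbol. Adding the two counts avoids any comparison and still
-- covers the space bound.
middleLayers : {A : Set} → Poly → List A → ℕ
middleLayers p w = eval p (length w) ℕ.+ length (others (others w))

length-others : ∀ {A : Set} (w : List A) → length (others (others w)) ℕ.≤ length w
length-others []          = z≤n
length-others (_ ∷ [])    = z≤n
length-others (_ ∷ _ ∷ v) = ℕ.m≤n+m (length v) 2

module _ {k : ℕ} (p : Poly) (a₀ a₁ a₂ a₃ b₀ b₁ b₂ : List (Piece (Fin k))) where
  open Printer k

  printed : List (Fin k) → List Symbol
  printed w = let m = middleLayers p w; u = others (others w) in
    render 0 (firstSymbol w) a₀ ++ render 0 (firstSymbol (others w)) a₁ ++
    layers (layer a₂) (length u) 0 u ++ layers (layer a₂) (eval p (length w)) (length u) []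
      ++ render m nothing a₃ ++
    render 0 nothing b₀ ++ layers (layer b₁) m 0 [] ++ render m nothing b₂

  -- Layers that meet the input are printed while it is read. At its end `N` is the input length,
  -- `horner` yields the number of further layers, and `sweep` prints them with blank input.
  main init : Program
  main = template a₀ ⨾ readNext ⨾ template a₁ ⨾ readNext ⨾ inputLoop a₂ ⨾ horner p ⨾ sweep a₂ ⨾
    template a₃ ⨾
         -- Turns the number of middle layers, reached by `I`, into the round count of the second
         -- sweep and resets the index to 0.
         loop I (incr X) ⨾ template b₀ ⨾ sweep b₁ ⨾ template b₂
  init = basic λ xs → (Vec.head xs , stay) ∷ Vec.replicate 5 (just zero , stay) , nothing

  layerBound : ℕ → ℕ
  layerBound n = eval p n ℕ.+ n

  -- One summand for each part of `main`, in order; `M` bounds every layer index.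
  mainBound : ℕ → ℕ
  mainBound n =
    templateWeight a₀ ℕ.+ (1 ℕ.+
    (templateWeight a₁ ℕ.+ (1 ℕ.+
    ((n ℕ.* (templateWeight a₂ ℕ.* suc M ℕ.+ 3) ℕ.+ 1) ℕ.+
    (hornerCost p n ℕ.+
    ((e ℕ.* (templateWeight a₂ ℕ.* suc M ℕ.+ 2) ℕ.+ 1) ℕ.+
    (templateWeight a₃ ℕ.* suc M ℕ.+
    ((M ℕ.* 2 ℕ.+ 1) ℕ.+
    (templateWeight b₀ ℕ.+
    ((M ℕ.* (templateWeight b₁ ℕ.* suc M ℕ.+ 2) ℕ.+ 1) ℕ.+
    templateWeight b₂ ℕ.* suc M))))))))))
    where
    e = eval p n
    M = layerBound n

  mainBound-poly : IsPoly mainBound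
  mainBound-poly =
    c (templateWeight a₀) +-poly (c 1 +-poly
    (c (templateWeight a₁) +-poly (c 1 +-poly
    ((identity-poly *-poly (c (templateWeight a₂) *-poly sucM +-poly c 3) +-poly c 1) +-poly
    (horner-poly p +-poly
    ((e *-poly (c (templateWeight a₂) *-poly sucM +-poly c 2) +-poly c 1) +-poly
    (c (templateWeight a₃) *-poly sucM +-poly
    ((M *-poly c 2 +-poly c 1) +-poly
    (c (templateWeight b₀) +-poly
    ((M *-poly (c (templateWeight b₁) *-poly sucM +-poly c 2) +-poly c 1) +-poly
    c (templateWeight b₂) *-poly sucM))))))))))
    where
    c = constant-poly
    e : IsPoly (eval p)
    e = p , λ _ → refl
    M = e +-poly identity-poly
    sucM = c 1 +-poly M

  counted : ∀ w → length (others (others w)) ℕ.+ arrived (others w) (arrived w 0) ≡ length w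
  counted []          = refl
  counted (_ ∷ [])    = refl
  counted (_ ∷ _ ∷ v) = ℕ.+-comm (length v) 2

  module _ (w : List (Fin k)) where
    private
      n = length w
      e = eval p n
      u = others (others w)
      m = middleLayers p w
      M = layerBound n

    m≤M : m ℕ.≤ M
    m≤M = ℕ.+-monoʳ-≤ e (length-others w)

    at-zero : ∀ a → templateWeight a ℕ.* 1 ℕ.≤ templateWeight a
    at-zero a = ℕ.≤-reflexive (ℕ.*-identityʳ (templateWeight a))

    main-performs : Performs main (store w 0 0 0 0 0) (printed w) (mainBound n) (store [] n 0 0 0 m)
    main-performs =
      ⨾-performs (weaken (template-performs a₀ 0) (at-zero a₀)) (
      ⨾-performs (readNext-performs w) (
      ⨾-performs (weaken (template-performs a₁ 0) (at-zero a₁)) (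
      ⨾-performs (readNext-performs (others w)) (
      ⨾-performs (weaken
        (ending (cong₂ (λ n i → store [] n 0 0 0 i) (counted w) (ℕ.+-identityʳ (length u)))
          (inputLoop-performs a₂ M u 0
            (subst (ℕ._≤ M) (sym (ℕ.+-identityʳ (length u)))
            (ℕ.≤-trans (length-others w) (ℕ.m≤n+m n e)))))
        (ℕ.+-monoˡ-≤ 1 (ℕ.*-monoˡ-≤ _ (length-others w)))) (
      ⨾-performs (horner-performs p n) (
      ⨾-performs (sweep-performs a₂ M e (length u) m≤M) (
      ⨾-performs (weaken (template-performs a₃ m) (template≤ a₃ M m≤M)) (
      ⨾-performs (weaken
        (ending (cong (λ x → store [] n 0 x 0 0) (ℕ.+-identityʳ m))
          (transfer I X (λ i x → n ∷ 0 ∷ x ∷ 0 ∷ i ∷ []) (λ _ _ → refl) (λ _ _ → refl)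
            (λ _ _ → refl) m 0))
        (ℕ.+-monoˡ-≤ 1 (ℕ.*-monoˡ-≤ 2 m≤M))) (
      ⨾-performs (weaken (template-performs b₀ 0) (at-zero b₀)) (
      ⨾-performs (weaken
        (ending (cong (λ i → store [] n 0 0 0 i) (ℕ.+-identityʳ m))
          (sweep-performs b₁ M m 0 (subst (ℕ._≤ M) (sym (ℕ.+-identityʳ m)) m≤M)))
        (ℕ.+-monoˡ-≤ 1 (ℕ.*-monoˡ-≤ _ m≤M)))
      (weaken (template-performs b₂ m) (template≤ b₂ M m≤M))))))))))))

  printer : TM (Fin k) Symbol
  printer = machine suc (init ⨾ main)

  abstract
    time-poly : IsPoly (λ n → 1 ℕ.+ mainBound n)
    time-poly = constant-poly 1 +-poly mainBound-poly

  printer-computes : TM.ComputesInTime printer (eval (proj₁ time-poly)) printed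
  printer-computes w = subst (λ c → Halted c × output c ≡ printed w) (sym final) (refl , refl)
    where
    open TM printer using (Halted; output; run; initial; ⟨_,_,_⟩)

    tapes₁ : Tapes
    tapes₁ = wordTape (List.map suc w) ∷ Vec.replicate 5 (tape [] (just zero) [])

    started : Represents (store w 0 0 0 0 0) tapes₁
    started = word w ∷ zero {0} ∷ zero {0} ∷ zero {0} ∷ zero {0} ∷ zero {0} ∷ []
      where
      word : ∀ w → ∃[ l ] wordTape (List.map suc w) ≡ inputTape l w
      word []      = [] , refl
      word (_ ∷ _) = [] , refl

    open Outcome (main-performs w started)

    execution : Runs (init ⨾ main) (wordTape (List.map suc w) ∷ Vec.replicate 5 emptyTape)
      (printed w) (1 ℕ.+ time) tapes′
    execution = Exec-left {p = init} {q = main} (step done) runs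

    final : run (eval (proj₁ time-poly) (length w)) (initial w) ≡ ⟨ nothing , tapes′ , printed w ⟩
    final = Exec-run-≤ suc (init ⨾ main) execution
      (ℕ.≤-trans (s≤s time≤) (ℕ.≤-reflexive (proj₂ time-poly (length w))))

module _ {k : ℕ} {Lang : Language (Fin k)} (M : TM (Fin k) ⊥) (p : Poly)
  (decides : TM.DecidesInSpace M (eval p) Lang) where
  open Reduction M
  open Printer k using (layer)

  -- The separators and the start location of the encoding are absorbed into adjacent templates, so
  -- `main` needs no separate output steps for them.
  topTemplate startTemplate finalTemplate : Template
  topTemplate   = nondetLayer 1 ++ text [ end ]
  startTemplate = startBlock ++ probFixed ++ probBottom
  finalTemplate = probTop ++ text (end ∷ probab ∷ sep ∷ [])

  reduction : List (Fin k) → ValOneInstance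
  reduction w = Game.gameInstance (Bounded.automaton (middleLayers p w) w)

  print : List (Fin k) → List Symbol
  print = printed p nondetFixed (nondetLayer 0)
    (nondetLayer 1) topTemplate startTemplate probMiddle finalTemplate

  -- Matches the switch from `inputLoop` to `sweep`: once `u` is used up, the remaining rounds see
  -- no symbol.
  layers-+ : ∀ (f : ℕ → Maybe (Fin k) → List Symbol) u b i →
             layers f (b ℕ.+ length u) i u
               ≡ layers f (length u) i u ++ layers f b (length u ℕ.+ i) []
  layers-+ f []      b i = cong (λ b → layers f b i []) (ℕ.+-identityʳ b)
  layers-+ f (x ∷ u) b i rewrite ℕ.+-suc b (length u) = trans
    (cong (f i (just x) ++_)
      (trans (layers-+ f u b (suc i))
      (cong (λ j → layers f (length u) (suc i) u ++ layers f b j []) (ℕ.+-suc (length u) i))))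
    (sym (List.++-assoc (f i (just x)) _ _))

  symbolAt-beyond : ∀ b (u : List (Fin k)) → symbolAt (b ℕ.+ length u) u ≡ nothing
  symbolAt-beyond b (x ∷ u) rewrite ℕ.+-suc b (length u) = symbolAt-beyond b u
  symbolAt-beyond b []      = symbolAt-[] (b ℕ.+ 0)

  reduction-printed : ∀ w → print w ≡ encodeInstance (reduction w)
  reduction-printed w = sym (trans (Bounded.instance-encoded m w) reassociate)
    where
    m = middleLayers p w
    u = others (others w)
    e = eval p (length w)
    open ≡-Reasoning
    open Algebra.Solver.Monoid (List.++-monoid Symbol) using (solve; _⊕_; _⊜_)

    reassociate : _ ≡ print w
    reassociate = begin
      (A ++ B ++ layers nondets m 0 u ++ render m (symbolAt m u) (nondetLayer 1)) ∷ʳ end ++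
        (S ++ PF ++ PB ++ LP ++ render m (symbolAt {Fin k} m []) probTop) ∷ʳ end ++ Z
        ≡⟨ cong₃ (λ L T P → (A ++ B ++ L ++ T) ∷ʳ end ++ (S ++ PF ++ PB ++ LP ++ P) ∷ʳ end ++ Z)
             (layers-+ nondets u e 0)
             (cong (λ x → render m x (nondetLayer 1)) (symbolAt-beyond e u))
             (cong (λ x → render m x probTop) (symbolAt-[] m)) ⟩
      (A ++ B ++ (L₁ ++ layers nondets e (length u ℕ.+ 0) []) ++ T) ∷ʳ end ++
        (S ++ PF ++ PB ++ LP ++ PT) ∷ʳ end ++ Z
        ≡⟨ cong (λ i → (A ++ B ++ (L₁ ++ layers nondets e i []) ++ T) ∷ʳ end ++
          (S ++ PF ++ PB ++ LP ++ PT) ∷ʳ end ++ Z)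
             (ℕ.+-identityʳ (length u)) ⟩
      (A ++ B ++ (L₁ ++ L₂) ++ T) ∷ʳ end ++ (S ++ PF ++ PB ++ LP ++ PT) ∷ʳ end ++ Z
        ≡⟨ solve 12 (λ A B L₁ L₂ T E S PF PB LP PT Z →
             ((A ⊕ (B ⊕ ((L₁ ⊕ L₂) ⊕ T))) ⊕ E) ⊕ (((S ⊕ (PF ⊕ (PB ⊕ (LP ⊕ PT)))) ⊕ E) ⊕ Z) ⊜
             A ⊕ (B ⊕ (L₁ ⊕ (L₂ ⊕ ((T ⊕ E) ⊕ ((S ⊕ (PF ⊕ PB)) ⊕ (LP ⊕ (PT ⊕ (E ⊕ Z)))))))))
             refl A B L₁ L₂ T [ end ] S PF PB LP PT Z ⟩
      A ++ B ++ L₁ ++ L₂ ++ (T ++ [ end ]) ++ (S ++ PF ++ PB) ++ LP ++ PT ++ [ end ] ++ Z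
        ≡⟨ cong₃ (λ X Y P → A ++ B ++ L₁ ++ L₂ ++ X ++ Y ++ LP ++ P)
             (render-++ m nothing (nondetLayer 1) (text [ end ]))
             (trans (render-++ 0 nothing startBlock (probFixed ++ probBottom))
               (cong (S ++_) (render-++ 0 nothing probFixed probBottom)))
             (render-++ m nothing probTop (text (end ∷ probab ∷ sep ∷ []))) ⟨
      print w ∎
      where
      nondets = layer (nondetLayer 1)
      A  = render 0 (firstSymbol w) nondetFixed
      B  = render 0 (firstSymbol (others w)) (nondetLayer 0)
      L₁ = layers nondets (length u) 0 u
      L₂ = layers nondets e (length u) []
      T  = render m nothing (nondetLayer 1)
      S  = render 0 nothing startBlock
      PF = render 0 nothing probFixed
      PB = render 0 nothing probBottom
      LP = layers (layer probMiddle) m 0 []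
      PT = render m nothing probTop
      Z  = probab ∷ sep ∷ []

      cong₃ : ∀ {A B C D : Set} (f : A → B → C → D) {a a′ b b′ c c′} → a ≡ a′ → b ≡ b′ → c ≡ c′ →
        f a b c ≡ f a′ b′ c′
      cong₃ f refl refl refl = refl

  bound≤layers : ∀ (w : List (Fin k)) → eval p (length w) ℕ.≤ 2 ℕ.+ middleLayers p w
  bound≤layers w = ℕ.≤-trans (ℕ.m≤m+n _ _) (ℕ.m≤n+m _ 2)

  hardness : ∃[ g ] PolyTime (DecisionProblem.encode ValOneProblem ∘ g) ×
             (∀ w → Lang w ⇔ DecisionProblem.Yes ValOneProblem (g w))
  hardness = reduction , (printer p a₀ a₁ a₂ a₃ b₀ b₁ b₂ , proj₁ q , computes) ,
    λ w → Bounded.accepted⇔ValOne (middleLayers p w) w {eval p} {Lang} decides (bound≤layers w)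
    where
    a₀ = nondetFixed
    a₁ = nondetLayer 0
    a₂ = nondetLayer 1
    a₃ = topTemplate
    b₀ = startTemplate
    b₁ = probMiddle
    b₂ = finalTemplate
    q  = time-poly p a₀ a₁ a₂ a₃ b₀ b₁ b₂

    computes : TM.ComputesInTime (printer p a₀ a₁ a₂ a₃ b₀ b₁ b₂) (eval (proj₁ q))
      (encodeInstance ∘ reduction)
    computes w = map₂ (λ eq → trans eq (reduction-printed w))
      (printer-computes p a₀ a₁ a₂ a₃ b₀ b₁ b₂ w)

theorem9 : PSPACE-hard ValOneProblem
theorem9 L (M , p , decides) = hardness {Lang = L} M p decides
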